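{- There is an absolute constant $C>0$ such that the following holds. Let $n\ge 1$, $d\ge 1$, and let $\mathcal{C}:\{\pm1\}^n\times\{\pm1\}^n\to\{\pm1\}$ be a deterministic two-party communication protocol in which at most $d$ bits are communicated. Let $h:\{\pm1\}^n\to[-1,1]$ be its XOR-fiber. Then $$L_{1,1}(h)=\sum_{i=1}^n\bigl|\hat h(\{i\})\bigr|\le C\sqrt d .$$
   Context: For $x,y\in\{\pm1\}^n$, $x\odot y$ denotes the entrywise product. The XOR-fiber of $\mathcal{C}$ is $h(z)=\mathbb{E}_{\mathbf{x},\mathbf{y}}[\mathcal{C}(\mathbf{x},\mathbf{y})\mid \mathbf{x}\odot\mathbf{y}=z]$, where $\mathbf{x},\mathbf{y}$ are independent and uniform on $\{\pm1\}^n$. Every $f:\{\pm1\}^n\to\mathbb{R}$ has a unique expansion $f(x)=\sum_{S\subseteq[n]}\hat f(S)\prod_{i\in S}x_i$ with $\hat f(S)=\mathbb{E}[f(\mathbf{x})\prod_{i\in S}\mathbf{x}_i]$ for uniform $\mathbf{x}$, and the level-$k$ Fourier growth is $L_{1,k}(f)=\sum_{|S|=k}|\hat f(S)|$. -}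

module Defs where

open import Data.Bool using (Bool)
open import Data.Fin.Subset using (Subset; inside; outside; ⁅_⁆)
import Data.Fin.Subset as Subset
open import Data.Integer using (+_)
open import Data.List
  using (List; []; _∷_; _++_; map; foldr; filter; length; allFin; cartesianProduct)
open import Data.Nat using (ℕ; zero; suc)
import Data.Nat as ℕ
open import Data.Product using (_,_)
open import Data.Rational using (ℚ; 0ℚ; 1ℚ; _+_; _*_; -_; _/_; ∣_∣)
open import Data.Sign using (Sign)
import Data.Sign as Sign
import Data.Sign.Properties as Sign
open import Data.Vec using (Vec; []; _∷_; zipWith)
import Data.Vec.Properties as Vec
open import Relation.Binary.Definitions using (DecidableEquality)
open import Relation.Unary using (Decidable)

sum : List ℚ → ℚ
sum = foldr _+_ 0ℚ

-- The empty list gets the junk value 0; every list averaged below for the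
-- theorem is non-empty.
mean : List ℚ → ℚ
mean []            = 0ℚ
mean qs@(_ ∷ qs′) = sum qs * (+ 1 / suc (length qs′))

-- 𝔼[ f ∣ P ] for a uniform element of the (duplicate-free) sample space Ω.
condMean : {A : Set} (Ω : List A) {P : A → Set} → Decidable P → (A → ℚ) → ℚ
condMean Ω P? f = mean (map f (filter P? Ω))

Cube : ℕ → Set
Cube n = Vec Sign n

allVecs : {A : Set} → A → A → (n : ℕ) → List (Vec A n)
allVecs a b zero    = [] ∷ []
allVecs a b (suc n) = map (a ∷_) (allVecs a b n) ++ map (b ∷_) (allVecs a b n)

cube : (n : ℕ) → List (Cube n)
cube = allVecs Sign.+ Sign.-

subsets : (n : ℕ) → List (Subset n)
subsets = allVecs inside outside

_≟_ : {n : ℕ} → DecidableEquality (Cube n)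
_≟_ = Vec.≡-dec Sign._≟_

infixl 7 _⊙_
_⊙_ : {n : ℕ} → Cube n → Cube n → Cube n
_⊙_ = zipWith Sign._*_

signℚ : Sign → ℚ
signℚ Sign.+ = 1ℚ
signℚ Sign.- = - 1ℚ

-- The character ∏_{i ∈ S} xᵢ.
χ : {n : ℕ} → Subset n → Cube n → Sign
χ []            []      = Sign.+
χ (inside  ∷ S) (s ∷ x) = s Sign.* χ S x
χ (outside ∷ S) (_ ∷ x) = χ S x

-- All functions occurring here are rational-valued: the average of finitely
-- many signs is rational.
fourier : {n : ℕ} → (Cube n → ℚ) → Subset n → ℚ
fourier {n} f S = mean (map (λ x → f x * signℚ (χ S x)) (cube n))

-- L₁,ₖ(f) = Σ_{|S| = k} |f̂(S)|
L₁ : {n : ℕ} → ℕ → (Cube n → ℚ) → ℚ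
L₁ {n} k f =
  sum (map (λ S → ∣ fourier f S ∣) (filter (λ S → Subset.∣ S ∣ ℕ.≟ k) (subsets n)))

-- Σᵢ |f̂({i})|
singletonSum : {n : ℕ} → (Cube n → ℚ) → ℚ
singletonSum {n} f = sum (map (λ i → ∣ fourier f ⁅ i ⁆ ∣) (allFin n))

-- A deterministic two-party protocol tree.  At an internal node the owner
-- sends one bit, an arbitrary function of the owner's input; dependence on the
-- earlier transcript is carried by the position in the tree.  The output is a
-- function of the full transcript, so it labels the leaves.
data Protocol (X Y O : Set) : Set where
  output : O → Protocol X Y O
  alice  : (X → Bool) → (Bool → Protocol X Y O) → Protocol X Y O
  bob    : (Y → Bool) → (Bool → Protocol X Y O) → Protocol X Y O

module _ {X Y O : Set} where

  transcript : Protocol X Y O → X → Y → List Bool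
  transcript (output _)  x y = []
  transcript (alice a π) x y = a x ∷ transcript (π (a x)) x y
  transcript (bob b π)   x y = b y ∷ transcript (π (b y)) x y

  run : Protocol X Y O → X → Y → O
  run (output o)  x y = o
  run (alice a π) x y = run (π (a x)) x y
  run (bob b π)   x y = run (π (b y)) x y

  Communicates≤ : ℕ → Protocol X Y O → Set
  Communicates≤ d π = ∀ x y → length (transcript π x y) ℕ.≤ d

xorFiber : {n : ℕ} → (Cube n → Cube n → Sign) → Cube n → ℚ
xorFiber {n} 𝒞 z =
  condMean (cartesianProduct (cube n) (cube n))
           (λ (x , y) → (x ⊙ y) ≟ z)
           (λ (x , y) → signℚ (𝒞 x y))

-- q ≤ c √d in squared form; faithful when q and c are non-negative.
infix 4 _≤_√_
_≤_√_ : ℚ → ℚ → ℕ → Set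
q ≤ c √ d = q * q Data.Rational.≤ c * c * (+ d / 1)

-- Let N = 2ⁿ and let ηᵢ be the sign of ĥ({i}); then N² Σᵢ |ĥ({i})| is the sum of
-- 𝒞(x,y) ⟨x,y⟩ over all x, y, where ⟨x,y⟩ = Σᵢ ηᵢ xᵢ yᵢ.
-- A rectangle u × v of the cube on which x and y have entropy deficiencies δ and δ′
-- satisfies 𝔼[(⟨x,y⟩ + g(y))²] ≥ n - 4δ - 4δ′ for every shift g: induct on n, averaging
-- over the first bit of y and using that a bit of bias b has deficiency at least
-- b²/4.  A message splits a side of the rectangle, and the entropy lost on average is
-- at most one bit, so inducting on the tree with g constant at each leaf gives
-- 0 ≤ 𝔼[⟨x,y⟩² - n + l² + 4 #bits - 2 l 𝒞 ⟨x,y⟩] for all l.  As 𝔼 ⟨x,y⟩² = n, taking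
-- l = 𝔼[𝒞 ⟨x,y⟩] yields l² ≤ 4 d.
-- To stay in the rationals, 4 m log₂ m in the entropies of u and v is replaced by a
-- piecewise quadratic C¹ function of m that agrees with it at the powers of two and is
-- still convex enough.

module Submission where

open import Defs
open import Data.Bool using (Bool; true; false)
open import Data.Empty using (⊥-elim)
open import Data.Fin using (Fin; suc)
open import Data.Fin.Subset using (Subset; inside; outside; ⁅_⁆)
import Data.Fin.Subset as Subset
import Data.Fin.Subset.Properties as Subset
open import Data.Integer using (+_)
import Data.Integer as ℤ
import Data.Integer.Properties as ℤ
open import Data.List
  using ([]; _∷_; _++_; length; map; filter; allFin; tabulate; cartesianProduct)
import Data.List.Properties as List
open import Data.List.Relation.Unary.All using (universal)
open import Data.Nat using (ℕ; zero; suc; z≤n; s≤s)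
import Data.Nat as ℕ
import Data.Nat.Properties as ℕ
import Data.Nat.Solver as ℕ
open import Data.Product using (∃-syntax; _×_; _,_; proj₁; proj₂)
open import Data.Rational
  using (ℚ; 0ℚ; 1ℚ; ½; _<_; _≤_; _+_; _*_; -_; _-_; _/_; ∣_∣; 1/_; nonNegative; toℚᵘ)
open import Data.Rational.Properties hiding (_≟_)
import Data.Rational.Properties as ℚ
import Data.Rational.Unnormalised as ℚᵘ
import Data.Rational.Unnormalised.Properties as ℚᵘ
open import Data.Sign using (Sign)
import Data.Sign as Sign
import Data.Sign.Properties as Sign
open import Data.Sum using (_⊎_; inj₁; inj₂)
open import Data.Unit using (tt)
open import Data.Vec using (Vec; []; _∷_; lookup)
import Data.Vec as Vec
import Data.Vec.Properties as Vec
open import Function using (flip; _∘_)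
open import Level using (0ℓ)
open import Relation.Binary.Definitions using (tri<; tri≈; tri>)
open import Relation.Binary.PropositionalEquality
  using (_≡_; _≢_; refl; sym; trans; cong; cong₂; subst; subst₂; module ≡-Reasoning)
open import Relation.Nullary using (¬_; yes; no)
open import Relation.Nullary.Decidable using (dec⇒maybe; toWitness)
open import Relation.Unary using (Decidable)
open import Tactic.RingSolver using (solve-∀)
open import Tactic.RingSolver.Core.AlmostCommutativeRing
  using (AlmostCommutativeRing; fromCommutativeRing)

-- Rational arithmetic and the embedding of the naturals.

ring : AlmostCommutativeRing 0ℓ 0ℓ
ring = fromCommutativeRing +-*-commutativeRing (λ q → dec⇒maybe (0ℚ ℚ.≟ q))

2ℚ 4ℚ : ℚ
2ℚ = + 2 / 1
4ℚ = + 4 / 1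

0≤+ : ∀ {p q} → 0ℚ ≤ p → 0ℚ ≤ q → 0ℚ ≤ p + q
0≤+ = +-mono-≤

0≤* : ∀ {p q} → 0ℚ ≤ p → 0ℚ ≤ q → 0ℚ ≤ p * q
0≤* {p} {q} 0≤p 0≤q =
  nonNegative⁻¹ (p * q) {{nonNeg*nonNeg⇒nonNeg p {{nonNegative 0≤p}} q {{nonNegative 0≤q}}}}

0≤p*p : ∀ p → 0ℚ ≤ p * p
0≤p*p p with ≤-total 0ℚ p
... | inj₁ 0≤p = 0≤* 0≤p 0≤p
... | inj₂ p≤0 = subst (0ℚ ≤_) (-p*-p p) (0≤* 0≤-p 0≤-p)
  where
  0≤-p = neg-antimono-≤ p≤0
  -p*-p : ∀ p → - p * - p ≡ p * p
  -p*-p = solve-∀ ring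

≤⇒0≤- : ∀ {p q} → p ≤ q → 0ℚ ≤ q - p
≤⇒0≤- {p} {q} p≤q = subst (_≤ q - p) (+-inverseʳ p) (+-monoˡ-≤ (- p) p≤q)

0≤-⇒≤ : ∀ {p q} → 0ℚ ≤ q - p → p ≤ q
0≤-⇒≤ {p} {q} 0≤q-p = subst₂ _≤_ (+-identityˡ p) (q-p+p q p) (+-monoˡ-≤ p 0≤q-p)
  where
  q-p+p : ∀ q p → (q - p) + p ≡ q
  q-p+p = solve-∀ ring

-- The ring solver knows nothing of relations such as h t = 1. The difference of the two sides is
-- therefore written as (e - 1) z, with the cofactor z supplied by hand, and it vanishes once e = 1.
cancel-unit : ∀ {x y e z} → e ≡ 1ℚ → x ≡ y + (e - 1ℚ) * z → x ≡ y
cancel-unit {y = y} {z = z} refl eq = trans eq (lemma y z)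
  where
  lemma : ∀ y z → y + (1ℚ - 1ℚ) * z ≡ y
  lemma = solve-∀ ring

ι : ℕ → ℚ
ι n = + n / 1

ι-+ : ∀ m n → ι (m ℕ.+ n) ≡ ι m + ι n
ι-+ m n = toℚᵘ-injective (begin
  toℚᵘ (ι (m ℕ.+ n))            ≈⟨ toℚᵘ-fromℚᵘ (ℚᵘ.mkℚᵘ (+ (m ℕ.+ n)) 0) ⟩
  ℚᵘ.mkℚᵘ (+ (m ℕ.+ n)) 0       ≈⟨ ℚᵘ.*≡* (cong (ℤ._* + 1) lemma) ⟩
  ℚᵘ.mkℚᵘ (+ m) 0 ℚᵘ.+ ℚᵘ.mkℚᵘ (+ n) 0
    ≈⟨ ℚᵘ.+-cong (toℚᵘ-fromℚᵘ (ℚᵘ.mkℚᵘ (+ m) 0)) (toℚᵘ-fromℚᵘ (ℚᵘ.mkℚᵘ (+ n) 0)) ⟨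
  toℚᵘ (ι m) ℚᵘ.+ toℚᵘ (ι n)    ≈⟨ toℚᵘ-homo-+ (ι m) (ι n) ⟨
  toℚᵘ (ι m + ι n)              ∎)
  where
  open ℚᵘ.≃-Reasoning
  lemma : + (m ℕ.+ n) ≡ + m ℤ.* + 1 ℤ.+ + n ℤ.* + 1
  lemma = sym (cong₂ ℤ._+_ (ℤ.*-identityʳ (+ m)) (ℤ.*-identityʳ (+ n)))

0≤ι : ∀ n → 0ℚ ≤ ι n
0≤ι n = nonNegative⁻¹ (ι n) {{normalize-nonNeg n 1}}

ι-mono : ∀ {m n} → m ℕ.≤ n → ι m ≤ ι n
ι-mono {m} {n} m≤n = subst (ι m ≤_) (trans (sym (ι-+ m (n ℕ.∸ m))) (cong ι (ℕ.m+[n∸m]≡n m≤n)))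
  (subst (_≤ ι m + ι (n ℕ.∸ m)) (+-identityʳ (ι m)) (+-monoʳ-≤ (ι m) (0≤ι (n ℕ.∸ m))))

-- Powers of two and the piecewise quadratic substitute for 4 m log₂ m.

h : ℕ → ℚ
h zero    = 1ℚ
h (suc k) = ½ * h k

0≤h : ∀ k → 0ℚ ≤ h k
0≤h zero    = toWitness {a? = 0ℚ ≤? 1ℚ} tt
0≤h (suc k) = 0≤* (toWitness {a? = 0ℚ ≤? ½} tt) (0≤h k)

ι-2^suc : ∀ k → ι (2 ℕ.^ suc k) ≡ 2ℚ * ι (2 ℕ.^ k)
ι-2^suc k = begin
  ι (t ℕ.+ (t ℕ.+ 0))  ≡⟨ cong (λ s → ι (t ℕ.+ s)) (ℕ.+-identityʳ t) ⟩
  ι (t ℕ.+ t)          ≡⟨ ι-+ t t ⟩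
  ι t + ι t            ≡⟨ lemma (ι t) ⟩
  2ℚ * ι t             ∎
  where
  open ≡-Reasoning
  t = 2 ℕ.^ k
  lemma : ∀ x → x + x ≡ 2ℚ * x
  lemma = solve-∀ ring

h*2^ : ∀ k → h k * ι (2 ℕ.^ k) ≡ 1ℚ
h*2^ zero    = refl
h*2^ (suc k) =
  trans (cong (h (suc k) *_) (ι-2^suc k)) (trans (lemma (h k) (ι (2 ℕ.^ k))) (h*2^ k))
  where
  lemma : ∀ h t → (½ * h) * (2ℚ * t) ≡ h * t
  lemma = solve-∀ ring

-- On [2ᵏ, 2ᵏ⁺¹] the substitute for 4 x log₂ x is Qₖ below; Rₖ is the piece Qₖ₋₁, which
-- makes sense for k = 0 too.
Q R : ℚ → ℚ → ℚ → ℚ → ℚ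
Q κ h t x = (4ℚ * κ + 2ℚ) * x + 2ℚ * h * (x * x) - 4ℚ * t
R κ h t x = (4ℚ * κ - 2ℚ) * x + 4ℚ * h * (x * x) - 2ℚ * t

Qₖ Rₖ : ℕ → ℚ → ℚ
Qₖ k = Q (ι k) (h k) (ι (2 ℕ.^ k))
Rₖ k = R (ι k) (h k) (ι (2 ℕ.^ k))

2^k<2^suc : ∀ k → 2 ℕ.^ k ℕ.< 2 ℕ.^ suc k
2^k<2^suc k = ℕ.^-monoʳ-< 2 (s≤s (s≤s z≤n)) (ℕ.n<1+n k)

dyadic : ∀ m → ∃[ k ] 2 ℕ.^ k ℕ.≤ suc m × suc m ℕ.< 2 ℕ.^ suc k
dyadic zero = 0 , s≤s z≤n , s≤s (s≤s z≤n)
dyadic (suc m) with dyadic m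
... | k , l , u with suc (suc m) ℕ.<? 2 ℕ.^ suc k
...   | yes u′ = k , ℕ.m≤n⇒m≤1+n l , u′
...   | no  l′ = suc k , ℕ.≮⇒≥ l′ , ℕ.≤-<-trans u (2^k<2^suc (suc k))

dyadic-unique : ∀ {m} j k → 2 ℕ.^ j ℕ.≤ m → m ℕ.< 2 ℕ.^ suc j →
                2 ℕ.^ k ℕ.≤ m → m ℕ.< 2 ℕ.^ suc k → j ≡ k
dyadic-unique j k lj uj lk uk with ℕ.<-cmp j k
... | tri≈ _ j≡k _ = j≡k
... | tri< j<k _ _ = ⊥-elim (ℕ.<⇒≱ uj (ℕ.≤-trans (ℕ.^-monoʳ-≤ 2 j<k) lk))
... | tri> _ _ k<j = ⊥-elim (ℕ.<⇒≱ uk (ℕ.≤-trans (ℕ.^-monoʳ-≤ 2 k<j) lj))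

G : ℕ → ℚ
G zero    = 0ℚ
G (suc m) = Qₖ (proj₁ (dyadic m)) (ι (suc m))

G-dyadic : ∀ {m} k → 2 ℕ.^ k ℕ.≤ m → m ℕ.< 2 ℕ.^ suc k → G m ≡ Qₖ k (ι m)
G-dyadic {zero} k l u = ⊥-elim (ℕ.<⇒≱ (ℕ.m^n>0 2 k) l)
G-dyadic {suc m} k l u with dyadic m
... | j , lj , uj = cong (λ i → Qₖ i (ι (suc m))) (dyadic-unique j k lj uj l u)

-- The value is that of 4 m log₂ m itself. This exactness is what gives the whole cube deficiency
-- zero in `D-ones`.
G-2^ : ∀ k → G (2 ℕ.^ k) ≡ 4ℚ * ι k * ι (2 ℕ.^ k)
G-2^ k = trans (G-dyadic k ℕ.≤-refl (2^k<2^suc k))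
               (cancel-unit (h*2^ k) (lemma (ι k) (h k) (ι (2 ℕ.^ k))))
  where
  lemma : ∀ κ h t → (4ℚ * κ + 2ℚ) * t + 2ℚ * h * (t * t) - 4ℚ * t
                    ≡ 4ℚ * κ * t + (h * t - 1ℚ) * (2ℚ * t)
  lemma = solve-∀ ring

Q≡R-suc : ∀ k x → Qₖ k x ≡ Rₖ (suc k) x
Q≡R-suc k x = begin
  Q (ι k) (h k) (ι (2 ℕ.^ k)) x                      ≡⟨ lemma (ι k) (h k) (ι (2 ℕ.^ k)) x ⟩
  R (1ℚ + ι k) (½ * h k) (2ℚ * ι (2 ℕ.^ k)) x
    ≡⟨ cong₂ (λ κ t → R κ (½ * h k) t x) (ι-+ 1 k) (ι-2^suc k) ⟨
  Rₖ (suc k) x                                       ∎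
  where
  open ≡-Reasoning
  lemma : ∀ κ h t x → (4ℚ * κ + 2ℚ) * x + 2ℚ * h * (x * x) - 4ℚ * t
            ≡ (4ℚ * (1ℚ + κ) - 2ℚ) * x + 4ℚ * (½ * h) * (x * x) - 2ℚ * (2ℚ * t)
  lemma = solve-∀ ring

-- Consecutive pieces are tangent at 2ᵏ and become flatter: `Rₖ k` minus `Rₖ (suc k)` is 2 h (x -
-- 2ᵏ)². So every later piece lies below the piece that gives the value of `G`.
R≤G : ∀ k q → q ℕ.≤ 2 ℕ.^ k → 0ℚ ≤ G q - Rₖ k (ι q)
-- At q = 0 the convention G 0 = 0 lies 2 above `Rₖ 0`; at q = 1 both sides vanish.
R≤G zero zero    _ = toWitness {a? = 0ℚ ≤? _} tt
R≤G zero (suc zero) _ = toWitness {a? = 0ℚ ≤? _} tt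
R≤G zero (suc (suc q)) (s≤s ())
R≤G (suc k) q q≤ with q ℕ.≤? 2 ℕ.^ k
... | yes q≤2^k = subst (0ℚ ≤_)
        (trans (sym (cancel-unit (h*2^ k) (lemma (G q) (ι k) (h k) t (ι q))))
               (cong (λ r → G q - r) (Q≡R-suc k (ι q))))
        (0≤+ (R≤G k q q≤2^k) (0≤* (0≤* (0≤ι 2) (0≤h k)) (0≤p*p (ι q - t))))
  where
  t = ι (2 ℕ.^ k)
  lemma : ∀ g κ h t x →
    g - ((4ℚ * κ + 2ℚ) * x + 2ℚ * h * (x * x) - 4ℚ * t)
    ≡ (g - ((4ℚ * κ - 2ℚ) * x + 4ℚ * h * (x * x) - 2ℚ * t) + 2ℚ * h * ((x - t) * (x - t)))
      + (h * t - 1ℚ) * (4ℚ * x - 2ℚ * t)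
  lemma = solve-∀ ring
... | no q≰2^k with ℕ.m≤n⇒m<n∨m≡n q≤
-- Strictly between 2ᵏ and 2ᵏ⁺¹ there is equality. The endpoint 2ᵏ⁺¹ already belongs to the next
-- piece, so its value comes from `G-2^`.
...   | inj₁ q< = ≤-reflexive (sym (begin
          G q - Rₖ (suc k) (ι q)             ≡⟨ cong₂ _-_ (G-dyadic k (ℕ.<⇒≤ (ℕ.≰⇒> q≰2^k)) q<) (sym (Q≡R-suc k (ι q))) ⟩
          Qₖ k (ι q) - Qₖ k (ι q)            ≡⟨ +-inverseʳ (Qₖ k (ι q)) ⟩
          0ℚ                                 ∎))
  where open ≡-Reasoning
...   | inj₂ refl = ≤-reflexive (sym (begin
          G q - Rₖ (suc k) t                ≡⟨ cong (_- Rₖ (suc k) t) (G-2^ (suc k)) ⟩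
          4ℚ * ι (suc k) * t - Rₖ (suc k) t  ≡⟨ cancel-unit (h*2^ (suc k)) (lemma (ι (suc k)) (h (suc k)) t) ⟩
          0ℚ                                 ∎))
  where
  open ≡-Reasoning
  t = ι (2 ℕ.^ suc k)
  lemma : ∀ κ h t → 4ℚ * κ * t - ((4ℚ * κ - 2ℚ) * t + 4ℚ * h * (t * t) - 2ℚ * t)
                    ≡ 0ℚ + (h * t - 1ℚ) * (- 4ℚ * t)
  lemma = solve-∀ ring

-- The entropy deficiency of a single bit.

-- With 4 m log₂ m for `G` this is 4 (p + q) (1 - H), where H is the binary entropy of p / (p + q):
-- four times the deficiency of a bit with weights p and q, scaled by p + q.
gap : ℕ → ℕ → ℚ
gap p q = 4ℚ * (ι p + ι q) + (G p + G q - G (p ℕ.+ q))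

gap-comm : ∀ p q → gap p q ≡ gap q p
gap-comm p q = cong₂ (λ s g → 4ℚ * s + g) (+-comm (ι p) (ι q))
  (cong₂ _-_ (+-comm (G p) (G q)) (cong G (ℕ.+-comm p q)))

Q-sum : ∀ {p q} k → 2 ℕ.^ k ℕ.≤ p ℕ.+ q → p ℕ.+ q ℕ.< 2 ℕ.^ suc k →
        G (p ℕ.+ q) ≡ Qₖ k (ι p + ι q)
Q-sum {p} {q} k l u = trans (G-dyadic k l u) (cong (Qₖ k) (ι-+ p q))

-- By `R≤G` both G p and G q may be replaced by `Rₖ k`. Then the linear and constant terms cancel
-- and 2 h (p - q)² remains, twice what is claimed.
gap-balanced : ∀ {p q} k → 2 ℕ.^ k ℕ.≤ p ℕ.+ q → p ℕ.+ q ℕ.< 2 ℕ.^ suc k →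
               p ℕ.≤ 2 ℕ.^ k → q ℕ.≤ 2 ℕ.^ k →
               0ℚ ≤ gap p q - h k * ((ι p - ι q) * (ι p - ι q))
gap-balanced {p} {q} k l u p≤ q≤ = subst (0ℚ ≤_)
  (trans (sym (lemma (ι p) (ι q) (G p) (G q) (ι k) (h k) (ι (2 ℕ.^ k))))
         (cong (λ g → 4ℚ * (ι p + ι q) + (G p + G q - g) - h k * ((ι p - ι q) * (ι p - ι q)))
               (sym (Q-sum {p} {q} k l u))))
  (0≤+ (0≤+ (R≤G k p p≤) (R≤G k q q≤)) (0≤* (0≤h k) (0≤p*p (ι p - ι q))))
  where
  lemma : ∀ x y g g′ κ h t →
    4ℚ * (x + y) + (g + g′ - ((4ℚ * κ + 2ℚ) * (x + y) + 2ℚ * h * ((x + y) * (x + y)) - 4ℚ * t))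
      - h * ((x - y) * (x - y))
    ≡ (g - ((4ℚ * κ - 2ℚ) * x + 4ℚ * h * (x * x) - 2ℚ * t)
       + (g′ - ((4ℚ * κ - 2ℚ) * y + 4ℚ * h * (y * y) - 2ℚ * t)))
      + h * ((x - y) * (x - y))
  lemma = solve-∀ ring

-- Here p and p + q lie in the same dyadic interval, so only G q has to be estimated. In terms of a
-- = 2ᵏ⁺¹ - (p + q) and b = p - 2ᵏ, both non-negative, what remains is h (a (a + 4 b) + 2 b²).
gap-skewed : ∀ {p q} k → p ℕ.+ q ℕ.< 2 ℕ.^ suc k → 2 ℕ.^ k ℕ.≤ p →
             0ℚ ≤ gap p q - h k * ((ι p - ι q) * (ι p - ι q))
gap-skewed {p} {q} k u l = subst (0ℚ ≤_)
  (trans (sym (cancel-unit (h*2^ k) (lemma (ι p) (ι q) (G q) (ι k) (h k) (ι (2 ℕ.^ k)))))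
         (cong₂ (λ g g′ → 4ℚ * (ι p + ι q) + (g + G q - g′) - h k * ((ι p - ι q) * (ι p - ι q)))
           (sym (G-dyadic k l (ℕ.≤-<-trans (ℕ.m≤m+n p q) u)))
           (sym (Q-sum {p} {q} k (ℕ.≤-trans l (ℕ.m≤m+n p q)) u))))
  (0≤+ (R≤G k q q≤)
       (0≤* (0≤h k) (0≤+ (0≤* 0≤2t-s (0≤+ 0≤2t-s (0≤+ 0≤p-t (0≤+ 0≤p-t (0≤+ 0≤p-t 0≤p-t)))))
                         (0≤* (0≤ι 2) (0≤p*p (ι p - t))))))
  where
  t = ι (2 ℕ.^ k)
  s≤2t : p ℕ.+ q ℕ.≤ 2 ℕ.* 2 ℕ.^ k
  s≤2t = ℕ.<⇒≤ u
  q≤ : q ℕ.≤ 2 ℕ.^ k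
  q≤ = ℕ.+-cancelˡ-≤ (2 ℕ.^ k) q (2 ℕ.^ k) (ℕ.≤-trans (ℕ.+-monoˡ-≤ q l)
         (ℕ.≤-trans s≤2t (ℕ.≤-reflexive (cong (2 ℕ.^ k ℕ.+_) (ℕ.+-identityʳ (2 ℕ.^ k))))))
  0≤2t-s : 0ℚ ≤ 2ℚ * t - (ι p + ι q)
  0≤2t-s = ≤⇒0≤- (subst₂ _≤_ (ι-+ p q) (ι-2^suc k) (ι-mono s≤2t))
  0≤p-t : 0ℚ ≤ ι p - t
  0≤p-t = ≤⇒0≤- (ι-mono l)
  lemma : ∀ x y g κ h t →
    4ℚ * (x + y) + (((4ℚ * κ + 2ℚ) * x + 2ℚ * h * (x * x) - 4ℚ * t) + g
                    - ((4ℚ * κ + 2ℚ) * (x + y) + 2ℚ * h * ((x + y) * (x + y)) - 4ℚ * t))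
      - h * ((x - y) * (x - y))
    ≡ (g - ((4ℚ * κ - 2ℚ) * y + 4ℚ * h * (y * y) - 2ℚ * t)
       + h * ((2ℚ * t - (x + y)) * ((2ℚ * t - (x + y)) + ((x - t) + ((x - t) + ((x - t) + (x - t)))))
              + 2ℚ * ((x - t) * (x - t))))
      + (h * t - 1ℚ) * (2ℚ * t - 4ℚ * x)
  lemma = solve-∀ ring

-- The curvature bound with h k in place of 1 / (p + q): it is stronger because 2ᵏ ≤ p + q, and
-- polynomial on each piece.
gap-curved : ∀ {p q} k → 2 ℕ.^ k ℕ.≤ p ℕ.+ q → p ℕ.+ q ℕ.< 2 ℕ.^ suc k →
             0ℚ ≤ gap p q - h k * ((ι p - ι q) * (ι p - ι q))
gap-curved {p} {q} k l u with ℕ.≤-total p (2 ℕ.^ k) | ℕ.≤-total q (2 ℕ.^ k)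
... | inj₂ l′ | _       = gap-skewed {p} {q} k u l′
... | inj₁ u′ | inj₁ u″ = gap-balanced {p} {q} k l u u′ u″
... | inj₁ _  | inj₂ l′ = subst (0ℚ ≤_)
  (cong₂ (λ g d → g - h k * d) (gap-comm q p) (lemma (ι p) (ι q)))
  (gap-skewed {q} {p} k (subst (ℕ._< 2 ℕ.^ suc k) (ℕ.+-comm p q) u) l′)
  where
  lemma : ∀ x y → (y - x) * (y - x) ≡ (x - y) * (x - y)
  lemma = solve-∀ ring

-- A bit with weights p and q, whose first value has probability `ratio`. The equations multiply
-- instead of dividing, so that p = q = 0 is allowed. `gap-bound` says that bias b = 2 `ratio` - 1
-- forces deficiency at least b²/4.
record Split (p q : ℕ) : Set where
  field
    ratio      : ℚ
    left       : ι p ≡ ι (p ℕ.+ q) * ratio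
    right      : ι q ≡ ι (p ℕ.+ q) * (1ℚ - ratio)
    0≤ratio    : 0ℚ ≤ ratio
    0≤1-ratio  : 0ℚ ≤ 1ℚ - ratio
    gap-bound  : 0ℚ ≤ gap p q - ι (p ℕ.+ q) * ((2ℚ * ratio - 1ℚ) * (2ℚ * ratio - 1ℚ))

ι-inverse : ∀ m → ∃[ r ] 0ℚ ≤ r × ι (suc m) * r ≡ 1ℚ
ι-inverse m = 1/ ι (suc m) , <⇒≤ (positive⁻¹ _ {{1/pos⇒pos (ι (suc m))}}) , *-inverseʳ (ι (suc m))
  where instance
  pos = normalize-pos (suc m) 1
  nz = pos⇒nonZero (ι (suc m))

split⁺ : ∀ p q s → p ℕ.+ q ≡ suc s → Split p q
split⁺ p q s s≡ with dyadic s | ι-inverse s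
... | k , l , u | r , 0≤r , s*r = record
  { ratio     = x * r
  ; left      = trans (cancel-unit unit (lemma₁ x y r)) (cong (_* (x * r)) (sym (ι-+ p q)))
  ; right     = trans (cancel-unit unit (lemma₂ x y r)) (cong (_* (1ℚ - x * r)) (sym (ι-+ p q)))
  ; 0≤ratio   = 0≤* (0≤ι p) 0≤r
  ; 0≤1-ratio = subst (0ℚ ≤_) (cancel-unit unit (lemma₃ x y r)) (0≤* (0≤ι q) 0≤r)
  -- With r = 1 / (p + q) the bias term equals r (p - q)². Passing from h k to r is harmless since h
  -- k - r = h k r (p + q - 2ᵏ), by h k 2ᵏ = 1.
  ; gap-bound = subst (0ℚ ≤_) (sym (begin
      gap p q - ι (p ℕ.+ q) * ((2ℚ * (x * r) - 1ℚ) * (2ℚ * (x * r) - 1ℚ))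
        ≡⟨ cong (λ w → gap p q - w * ((2ℚ * (x * r) - 1ℚ) * (2ℚ * (x * r) - 1ℚ))) (ι-+ p q) ⟩
      gap p q - (x + y) * ((2ℚ * (x * r) - 1ℚ) * (2ℚ * (x * r) - 1ℚ))
        ≡⟨ cancel-unit unit (lemma₄ (gap p q) x y r) ⟩
      gap p q - r * ((x - y) * (x - y))
        ≡⟨ cancel-unit unit (lemma₅ (gap p q) x y r (h k)) ⟩
      gap p q - h k * ((x - y) * (x - y)) + (h k * (r * (x + y)) - r) * ((x - y) * (x - y))
        ≡⟨ cancel-unit (h*2^ k) (lemma₆ (gap p q) x y r (h k) t) ⟩
      gap p q - h k * ((x - y) * (x - y)) + (h k * r) * (x + y - t) * ((x - y) * (x - y)) ∎))
      (0≤+ (gap-curved {p} {q} k l′ u′)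
           (0≤* (0≤* (0≤* (0≤h k) 0≤r) (≤⇒0≤- (subst (t ≤_) (ι-+ p q) (ι-mono l′))))
                (0≤p*p (x - y))))
  }
  where
  open ≡-Reasoning
  x = ι p
  y = ι q
  t = ι (2 ℕ.^ k)
  l′ : 2 ℕ.^ k ℕ.≤ p ℕ.+ q
  l′ = subst (2 ℕ.^ k ℕ.≤_) (sym s≡) l
  u′ : p ℕ.+ q ℕ.< 2 ℕ.^ suc k
  u′ = subst (ℕ._< 2 ℕ.^ suc k) (sym s≡) u
  unit : (x + y) * r ≡ 1ℚ
  unit = trans (cong (_* r) (trans (sym (ι-+ p q)) (cong ι s≡))) s*r
  lemma₁ : ∀ x y r → x ≡ (x + y) * (x * r) + ((x + y) * r - 1ℚ) * (- x)
  lemma₁ = solve-∀ ring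
  lemma₂ : ∀ x y r → y ≡ (x + y) * (1ℚ - x * r) + ((x + y) * r - 1ℚ) * x
  lemma₂ = solve-∀ ring
  lemma₃ : ∀ x y r → y * r ≡ 1ℚ - x * r + ((x + y) * r - 1ℚ) * 1ℚ
  lemma₃ = solve-∀ ring
  lemma₄ : ∀ g x y r →
    g - (x + y) * ((2ℚ * (x * r) - 1ℚ) * (2ℚ * (x * r) - 1ℚ))
    ≡ g - r * ((x - y) * (x - y))
      + ((x + y) * r - 1ℚ) * (x + y - 4ℚ * x * x * r)
  lemma₄ = solve-∀ ring
  lemma₅ : ∀ g x y r h →
    g - r * ((x - y) * (x - y))
    ≡ g - h * ((x - y) * (x - y)) + (h * (r * (x + y)) - r) * ((x - y) * (x - y))
      + ((x + y) * r - 1ℚ) * (- h * ((x - y) * (x - y)))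
  lemma₅ = solve-∀ ring
  lemma₆ : ∀ g x y r h t →
    g - h * ((x - y) * (x - y)) + (h * (r * (x + y)) - r) * ((x - y) * (x - y))
    ≡ g - h * ((x - y) * (x - y)) + (h * r) * (x + y - t) * ((x - y) * (x - y))
      + (h * t - 1ℚ) * (r * ((x - y) * (x - y)))
  lemma₆ = solve-∀ ring

split : ∀ p q → Split p q
split zero zero = record
  -- Without mass, any ratio in [0, 1] would do.
  { ratio     = 0ℚ
  ; left      = refl
  ; right     = refl
  ; 0≤ratio   = ≤-refl
  ; 0≤1-ratio = 0≤ι 1
  ; gap-bound = ≤-refl
  }
split zero    (suc q) = split⁺ 0 (suc q) q refl
split (suc p) q       = split⁺ (suc p) q (p ℕ.+ q) refl

-- Sums over the cube.

∑ : ∀ {n} → (Cube n → ℚ) → ℚ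
∑ {zero}  f = f []
∑ {suc n} f = ∑ (λ x → f (Sign.+ ∷ x)) + ∑ (λ x → f (Sign.- ∷ x))

∑-cong : ∀ {n} {f g : Cube n → ℚ} → (∀ x → f x ≡ g x) → ∑ f ≡ ∑ g
∑-cong {zero}  f≗g = f≗g []
∑-cong {suc n} f≗g = cong₂ _+_ (∑-cong {n} (λ x → f≗g _)) (∑-cong {n} (λ x → f≗g _))

interchange : ∀ a b c d → (a + b) + (c + d) ≡ (a + c) + (b + d)
interchange = solve-∀ ring

∑-+ : ∀ {n} (f g : Cube n → ℚ) → ∑ (λ x → f x + g x) ≡ ∑ f + ∑ g
∑-+ {zero}  f g = refl
∑-+ {suc n} f g =
  trans (cong₂ _+_ (∑-+ {n} _ _) (∑-+ {n} _ _)) (interchange (∑ {n} _) (∑ {n} _) (∑ {n} _) (∑ {n} _))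

∑-*ˡ : ∀ {n} c (f : Cube n → ℚ) → ∑ (λ x → c * f x) ≡ c * ∑ f
∑-*ˡ {zero}  c f = refl
∑-*ˡ {suc n} c f =
  trans (cong₂ _+_ (∑-*ˡ {n} c _) (∑-*ˡ {n} c _)) (sym (*-distribˡ-+ c (∑ {n} _) (∑ {n} _)))

∑-*ʳ : ∀ {n} c (f : Cube n → ℚ) → ∑ (λ x → f x * c) ≡ ∑ f * c
∑-*ʳ c f = trans (∑-cong (λ x → *-comm (f x) c)) (trans (∑-*ˡ c f) (*-comm c (∑ f)))

0≤∑ : ∀ {n} {f : Cube n → ℚ} → (∀ x → 0ℚ ≤ f x) → 0ℚ ≤ ∑ f
0≤∑ {zero}  0≤f = 0≤f []
0≤∑ {suc n} 0≤f = 0≤+ (0≤∑ {n} (λ x → 0≤f _)) (0≤∑ {n} (λ x → 0≤f _))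

∑-swap : ∀ {m n} (f : Cube m → Cube n → ℚ) → ∑ (λ x → ∑ (f x)) ≡ ∑ (λ y → ∑ (λ x → f x y))
∑-swap {zero}  f = refl
∑-swap {suc m} {n} f = trans (cong₂ _+_ (∑-swap {m} {n} _) (∑-swap {m} {n} _)) (sym (∑-+ {n} _ _))

-- Multisets in the cube and their entropy deficiency.

size : ∀ {n} → (Cube n → ℕ) → ℕ
size {zero}  u = u []
size {suc n} u = size (λ x → u (Sign.+ ∷ x)) ℕ.+ size (λ x → u (Sign.- ∷ x))

ι-size : ∀ {n} (u : Cube n → ℕ) → ι (size u) ≡ ∑ (λ x → ι (u x))
ι-size {zero}  u = refl
ι-size {suc n} u = trans (ι-+ (size {n} _) (size {n} _)) (cong₂ _+_ (ι-size {n} _) (ι-size {n} _))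

size-+ : ∀ {n} (u v : Cube n → ℕ) → size (λ x → u x ℕ.+ v x) ≡ size u ℕ.+ size v
size-+ {zero}  u v = refl
size-+ {suc n} u v = trans (cong₂ ℕ._+_ (size-+ {n} _ _) (size-+ {n} _ _))
  (ℕ.+-*-Solver.solve 4 (λ a b c d → (a :+ b) :+ (c :+ d) := (a :+ c) :+ (b :+ d)) refl (size {n} _) _ _ _)
  where open ℕ.+-*-Solver

-- D u / size u is four times the entropy deficiency of u, with G for 4 m log₂ m.
D : ∀ {n} → (Cube n → ℕ) → ℚ
D {n} u = 4ℚ * ι n * ι (size u) + (∑ (λ x → G (u x)) - G (size u))

-- Chain rule: the deficiency of the first bit plus that of the remaining bits given it.
D-suc : ∀ {n} (u : Cube (suc n) → ℕ) →
        let u₊ = λ x → u (Sign.+ ∷ x); u₋ = λ x → u (Sign.- ∷ x) in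
        D u ≡ D u₊ + D u₋ + gap (size u₊) (size u₋)
D-suc {n} u = trans
  (cong₂ (λ m s → 4ℚ * m * s + (∑ (λ x → G (u x)) - G (size u))) (ι-+ 1 n) (ι-+ s₊ s₋))
  (lemma (ι n) (ι s₊) (ι s₋) (∑ {n} _) (∑ {n} _) (G s₊) (G s₋) (G (size u)))
  where
  s₊ = size (λ x → u (Sign.+ ∷ x))
  s₋ = size (λ x → u (Sign.- ∷ x))
  lemma : ∀ n s s′ g g′ k k′ l →
    4ℚ * (1ℚ + n) * (s + s′) + ((g + g′) - l)
    ≡ (4ℚ * n * s + (g - k)) + (4ℚ * n * s′ + (g′ - k′)) + (4ℚ * (s + s′) + (k + k′ - l))
  lemma = solve-∀ ring

-- The chain rule in the other order: the deficiency of the remaining bits plus that of the first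
-- bit given them. Forgetting the first bit adds multiplicities, which is why the sides of
-- rectangles are functions to ℕ and not subsets.
D-fold : ∀ {n} (v : Cube (suc n) → ℕ) →
         let v₊ = λ y → v (Sign.+ ∷ y); v₋ = λ y → v (Sign.- ∷ y) in
         D v ≡ D (λ y → v₊ y ℕ.+ v₋ y) + ∑ (λ y → gap (v₊ y) (v₋ y))
D-fold {n} v = sym (begin
  D w + ∑ (λ y → gap (v₊ y) (v₋ y))
    ≡⟨ cong₂ (λ s γ → 4ℚ * ι n * ι s + (∑ (λ y → G (w y)) - G s) + γ) (size-+ v₊ v₋) ∑gap ⟩
  4ℚ * ι n * ι (size v) + (∑ (λ y → G (w y)) - G (size v)) + (4ℚ * ι (size v) + (g₊ + g₋ - ∑ (λ y → G (w y))))
    ≡⟨ lemma (ι n) (ι (size v)) (∑ (λ y → G (w y))) (G (size v)) g₊ g₋ ⟩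
  4ℚ * (1ℚ + ι n) * ι (size v) + (g₊ + g₋ - G (size v))
    ≡⟨ cong (λ m → 4ℚ * m * ι (size v) + (g₊ + g₋ - G (size v))) (ι-+ 1 n) ⟨
  D v ∎)
  where
  open ≡-Reasoning
  v₊ = λ y → v (Sign.+ ∷ y)
  v₋ = λ y → v (Sign.- ∷ y)
  w  = λ y → v₊ y ℕ.+ v₋ y
  g₊ = ∑ (λ y → G (v₊ y))
  g₋ = ∑ (λ y → G (v₋ y))
  ∑gap : ∑ (λ y → gap (v₊ y) (v₋ y)) ≡ 4ℚ * ι (size v) + (g₊ + g₋ - ∑ (λ y → G (w y)))
  ∑gap = begin
    ∑ (λ y → gap (v₊ y) (v₋ y))
      ≡⟨ ∑-cong (λ y → regroup (ι (v₊ y)) (ι (v₋ y)) (G (v₊ y)) (G (v₋ y)) (G (w y))) ⟩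
    ∑ (λ y → (4ℚ * ι (v₊ y) + G (v₊ y)) + (4ℚ * ι (v₋ y) + G (v₋ y)) + - 1ℚ * G (w y))
      ≡⟨ trans (∑-+ {n} _ _) (cong₂ _+_
           (trans (∑-+ {n} _ _) (cong₂ _+_ (part v₊) (part v₋)))
           (∑-*ˡ {n} (- 1ℚ) _)) ⟩
    (4ℚ * ι (size v₊) + g₊) + (4ℚ * ι (size v₋) + g₋) + - 1ℚ * ∑ (λ y → G (w y))
      ≡⟨ regroup (ι (size v₊)) (ι (size v₋)) g₊ g₋ (∑ (λ y → G (w y))) ⟨
    4ℚ * (ι (size v₊) + ι (size v₋)) + (g₊ + g₋ - ∑ (λ y → G (w y)))
      ≡⟨ cong (λ s → 4ℚ * s + (g₊ + g₋ - ∑ (λ y → G (w y)))) (ι-+ (size v₊) (size v₋)) ⟨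
    4ℚ * ι (size v) + (g₊ + g₋ - ∑ (λ y → G (w y))) ∎
    where
    regroup : ∀ x y g g′ k →
      4ℚ * (x + y) + (g + g′ - k) ≡ (4ℚ * x + g) + (4ℚ * y + g′) + - 1ℚ * k
    regroup = solve-∀ ring
    part : ∀ u → ∑ (λ y → 4ℚ * ι (u y) + G (u y)) ≡ 4ℚ * ι (size u) + ∑ {n} (λ y → G (u y))
    part u = trans (∑-+ {n} _ _) (cong (_+ ∑ (λ y → G (u y)))
      (trans (∑-*ˡ {n} 4ℚ _) (cong (4ℚ *_) (sym (ι-size u)))))
  lemma : ∀ n s c k g g′ →
    4ℚ * n * s + (c - k) + (4ℚ * s + (g + g′ - c)) ≡ 4ℚ * (1ℚ + n) * s + (g + g′ - k)
  lemma = solve-∀ ring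

-- The shifted second moment on a rectangle.

ip : ∀ {n} → Cube n → Cube n → Cube n → ℚ
ip []      []      []      = 0ℚ
ip (e ∷ η) (s ∷ x) (t ∷ y) = signℚ e * (signℚ s * signℚ t) + ip η x y

weighted : ∀ {m n} → (Cube m → ℕ) → (Cube n → ℕ) → (Cube m → Cube n → ℚ) → ℚ
weighted u v Φ = ∑ (λ x → ∑ (λ y → ι (u x) * ι (v y) * Φ x y))

-- This is 𝔼[Φ] + 4 δ + 4 δ′ ≥ 0 for independent x from u and y from v, multiplied by both sizes so
-- that empty sides need no separate treatment.
Good : ∀ {n} → (u v : Cube n → ℕ) → (Cube n → Cube n → ℚ) → Set
Good u v Φ = 0ℚ ≤ weighted u v Φ + (ι (size v) * D u + ι (size u) * D v)

signℚ-square : ∀ s → signℚ s * signℚ s ≡ 1ℚ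
signℚ-square Sign.+ = refl
signℚ-square Sign.- = refl

-- The two sides are treated differently: x is conditioned on its first bit, as in `D-suc`, while
-- the first bit of y is averaged out, as in `D-fold`. With the bit of x fixed, the new shift
-- depends on y alone, as the induction requires.
module Step {n} (e : Sign) (η : Cube n) (u v : Cube (suc n) → ℕ) (g : Cube (suc n) → ℚ) where

  u₊ u₋ v₊ v₋ w : Cube n → ℕ
  u₊ x = u (Sign.+ ∷ x)
  u₋ x = u (Sign.- ∷ x)
  v₊ y = v (Sign.+ ∷ y)
  v₋ y = v (Sign.- ∷ y)
  w y  = v₊ y ℕ.+ v₋ y

  g₊ g₋ a : Cube n → ℚ
  g₊ y = g (Sign.+ ∷ y)
  g₋ y = g (Sign.- ∷ y)
  a y  = Split.ratio (split (v₊ y) (v₋ y))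

  ε : ℚ
  ε = signℚ e

  -- Averaging over the first coordinate of y, which is ±1 with weights a y and
  -- 1 - a y, splits the second moment into mean and variance.
  centre κ : ℚ → Cube n → ℚ
  centre σ y = a y * (ε * σ + g₊ y) + (1ℚ - a y) * (g₋ y - ε * σ)
  κ σ y = ι (w y) * (a y * (1ℚ - a y)
            * ((2ℚ * (ε * σ) + (g₊ y - g₋ y)) * (2ℚ * (ε * σ) + (g₊ y - g₋ y))) - 1ℚ)

  shifted : ℚ → Cube n → Cube n → ℚ
  shifted σ x y = (ip η x y + centre σ y) * (ip η x y + centre σ y) - ι n

  Φ : Cube (suc n) → Cube (suc n) → ℚ
  Φ x y = (ip (e ∷ η) x y + g y) * (ip (e ∷ η) x y + g y) - ι (suc n)

  -- The conditional mean over the first bit of y goes into the new shift. The variance part `κ`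
  -- does not involve x, so its sum only picks up the factor `size μ`.
  row : ∀ s (μ : Cube n → ℕ) →
    ∑ (λ x → ∑ (λ y → ι (μ x) * ι (v₊ y) * Φ (s ∷ x) (Sign.+ ∷ y))
           + ∑ (λ y → ι (μ x) * ι (v₋ y) * Φ (s ∷ x) (Sign.- ∷ y)))
    ≡ weighted μ w (shifted (signℚ s)) + ι (size μ) * ∑ (κ (signℚ s))
  row s μ = begin
    ∑ (λ x → ∑ (λ y → ι (μ x) * ι (v₊ y) * Φ (s ∷ x) (Sign.+ ∷ y))
           + ∑ (λ y → ι (μ x) * ι (v₋ y) * Φ (s ∷ x) (Sign.- ∷ y)))
      ≡⟨ ∑-cong {n} inner ⟩
    ∑ (λ x → ∑ (λ y → ι (μ x) * ι (w y) * shifted σ x y) + ι (μ x) * ∑ (κ σ))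
      ≡⟨ ∑-+ {n} _ _ ⟩
    weighted μ w (shifted σ) + ∑ (λ x → ι (μ x) * ∑ (κ σ))
      ≡⟨ cong (λ r → weighted μ w (shifted σ) + r)
              (trans (∑-*ʳ {n} _ _) (cong (_* ∑ (κ σ)) (sym (ι-size μ)))) ⟩
    weighted μ w (shifted σ) + ι (size μ) * ∑ (κ σ) ∎
    where
    open ≡-Reasoning
    σ = signℚ s
    lemma : ∀ m v a r e s p q n →
      m * (v * a) * ((e * (s * 1ℚ) + r + p) * (e * (s * 1ℚ) + r + p) - (1ℚ + n))
      + m * (v * (1ℚ - a)) * ((e * (s * - 1ℚ) + r + q) * (e * (s * - 1ℚ) + r + q) - (1ℚ + n))
      ≡ m * v * ((r + (a * (e * s + p) + (1ℚ - a) * (q - e * s)))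
                 * (r + (a * (e * s + p) + (1ℚ - a) * (q - e * s))) - n)
        + m * (v * (a * (1ℚ - a) * ((2ℚ * (e * s) + (p - q)) * (2ℚ * (e * s) + (p - q))) - 1ℚ))
    lemma = solve-∀ ring
    point : ∀ x y →
      ι (μ x) * ι (v₊ y) * Φ (s ∷ x) (Sign.+ ∷ y) + ι (μ x) * ι (v₋ y) * Φ (s ∷ x) (Sign.- ∷ y)
      ≡ ι (μ x) * ι (w y) * shifted σ x y + ι (μ x) * κ σ y
    point x y = trans
      (cong₂ _+_
        (cong₂ (λ b m → ι (μ x) * b * (A * A - m)) (Split.left S) (ι-+ 1 n))
        (cong₂ (λ b m → ι (μ x) * b * (B * B - m)) (Split.right S) (ι-+ 1 n)))
      (lemma (ι (μ x)) (ι (w y)) (a y) (ip η x y) ε σ (g₊ y) (g₋ y) (ι n))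
      where
      S = split (v₊ y) (v₋ y)
      A = ε * (σ * 1ℚ) + ip η x y + g₊ y
      B = ε * (σ * - 1ℚ) + ip η x y + g₋ y
    inner : ∀ x → _
    inner x = begin
      ∑ (λ y → ι (μ x) * ι (v₊ y) * Φ (s ∷ x) (Sign.+ ∷ y))
      + ∑ (λ y → ι (μ x) * ι (v₋ y) * Φ (s ∷ x) (Sign.- ∷ y))
        ≡⟨ ∑-+ {n} _ _ ⟨
      ∑ (λ y → ι (μ x) * ι (v₊ y) * Φ (s ∷ x) (Sign.+ ∷ y)
             + ι (μ x) * ι (v₋ y) * Φ (s ∷ x) (Sign.- ∷ y))
        ≡⟨ ∑-cong {n} (point x) ⟩
      ∑ (λ y → ι (μ x) * ι (w y) * shifted σ x y + ι (μ x) * κ σ y)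
        ≡⟨ trans (∑-+ {n} _ _) (cong (λ r → ∑ (λ y → ι (μ x) * ι (w y) * shifted σ x y) + r) (∑-*ˡ {n} (ι (μ x)) (κ σ))) ⟩
      ∑ (λ y → ι (μ x) * ι (w y) * shifted σ x y) + ι (μ x) * ∑ (κ σ) ∎

  S₊ S₋ γ : ℚ
  S₊ = ι (size u₊)
  S₋ = ι (size u₋)
  γ  = gap (size u₊) (size u₋)

  remainder : Cube n → ℚ
  remainder y = S₊ * κ 1ℚ y + S₋ * κ (- 1ℚ) y + (ι (w y) * γ + (S₊ + S₋) * gap (v₊ y) (v₋ y))

  -- Let β and b be the biases of the first bits of x and y. As 4 a (1 - a) = 1 - b², averaging the
  -- variance over the bit of x gives a (1 - a) (2 ε β + δ)² + (1 - b²) (1 - β²). This falls short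
  -- of 1 by at most b² + β², which the two gaps cover through γ ≥ U β² and γ′ ≥ W b².
  0≤remainder : ∀ y → 0ℚ ≤ remainder y
  0≤remainder y = subst (0ℚ ≤_) (sym (begin
    remainder y
      ≡⟨ cong₂ (λ P M → P * κ 1ℚ y + M * κ (- 1ℚ) y + (ι (w y) * γ + U′ * γ′)) (Split.left T) (Split.right T) ⟩
    U * α * κ 1ℚ y + U * (1ℚ - α) * κ (- 1ℚ) y + (ι (w y) * γ + U′ * γ′)
      ≡⟨ cong (λ z → U * α * κ 1ℚ y + U * (1ℚ - α) * κ (- 1ℚ) y + (ι (w y) * γ + z * γ′))
              (ι-+ (size u₊) (size u₋)) ⟨
    U * α * κ 1ℚ y + U * (1ℚ - α) * κ (- 1ℚ) y + (ι (w y) * γ + U * γ′)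
      ≡⟨ cancel-unit (signℚ-square e) (lemma U α (ι (w y)) (a y) ε (g₊ y - g₋ y) γ γ′) ⟩
    W * (γ - U * (β * β)) + U * (γ′ - W * (b * b))
      + U * W * (a y * (1ℚ - a y) * ((2ℚ * (ε * β) + δ) * (2ℚ * (ε * β) + δ)) + (b * β) * (b * β)) ∎))
    (0≤+ (0≤+ (0≤* (0≤ι (w y)) (Split.gap-bound T)) (0≤* (0≤ι (size u)) (Split.gap-bound S)))
         (0≤* (0≤* (0≤ι (size u)) (0≤ι (w y)))
              (0≤+ (0≤* (0≤* (Split.0≤ratio S) (Split.0≤1-ratio S)) (0≤p*p (2ℚ * (ε * β) + δ)))
                   (0≤p*p (b * β)))))
    where
    open ≡-Reasoning
    T = split (size u₊) (size u₋)
    S = split (v₊ y) (v₋ y)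
    U = ι (size u)
    U′ = S₊ + S₋
    W = ι (w y)
    α = Split.ratio T
    γ′ = gap (v₊ y) (v₋ y)
    δ = g₊ y - g₋ y
    β = 2ℚ * α - 1ℚ
    b = 2ℚ * a y - 1ℚ
    lemma : ∀ U α W a e d γ γ′ →
      U * α * (W * (a * (1ℚ - a) * ((2ℚ * (e * 1ℚ) + d) * (2ℚ * (e * 1ℚ) + d)) - 1ℚ))
      + U * (1ℚ - α) * (W * (a * (1ℚ - a) * ((2ℚ * (e * - 1ℚ) + d) * (2ℚ * (e * - 1ℚ) + d)) - 1ℚ))
      + (W * γ + U * γ′)
      ≡ W * (γ - U * ((2ℚ * α - 1ℚ) * (2ℚ * α - 1ℚ))) + U * (γ′ - W * ((2ℚ * a - 1ℚ) * (2ℚ * a - 1ℚ)))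
        + U * W * (a * (1ℚ - a) * ((2ℚ * (e * (2ℚ * α - 1ℚ)) + d) * (2ℚ * (e * (2ℚ * α - 1ℚ)) + d))
                   + ((2ℚ * a - 1ℚ) * (2ℚ * α - 1ℚ)) * ((2ℚ * a - 1ℚ) * (2ℚ * α - 1ℚ)))
        + (e * e - 1ℚ) * (4ℚ * U * W * a * (1ℚ - a) * (1ℚ - (2ℚ * α - 1ℚ) * (2ℚ * α - 1ℚ)))
    lemma = solve-∀ ring

  ∑remainder : ∑ remainder ≡ S₊ * ∑ (κ 1ℚ) + S₋ * ∑ (κ (- 1ℚ))
                             + (ι (size w) * γ + (S₊ + S₋) * ∑ (λ y → gap (v₊ y) (v₋ y)))
  ∑remainder = trans (∑-+ {n} _ _) (cong₂ _+_
    (trans (∑-+ {n} _ _) (cong₂ _+_ (∑-*ˡ {n} S₊ (κ 1ℚ)) (∑-*ˡ {n} S₋ (κ (- 1ℚ)))))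
    (trans (∑-+ {n} _ _) (cong₂ _+_
      (trans (∑-*ʳ {n} _ _) (cong (_* γ) (sym (ι-size w))))
      (∑-*ˡ {n} (S₊ + S₋) _))))

  good : Good u₊ w (shifted 1ℚ) → Good u₋ w (shifted (- 1ℚ)) → Good u v Φ
  good good₊ good₋ = subst (0ℚ ≤_) (sym (begin
    weighted u v Φ + (ι (size v) * D u + ι (size u) * D v)
      ≡⟨ cong₂ _+_ (cong₂ _+_ (row Sign.+ u₊) (row Sign.- u₋))
           (cong₂ _+_ (cong₂ _*_ (cong ι (sym (size-+ v₊ v₋))) (D-suc u))
                      (cong₂ _*_ (ι-+ (size u₊) (size u₋)) (D-fold v))) ⟩
    ((W₊ + S₊ * K₊) + (W₋ + S₋ * K₋))
      + (ι (size w) * (D u₊ + D u₋ + γ) + (S₊ + S₋) * (D w + Γ))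
      ≡⟨ lemma W₊ W₋ S₊ S₋ K₊ K₋ (ι (size w)) (D u₊) (D u₋) γ (D w) Γ ⟩
    (W₊ + (ι (size w) * D u₊ + S₊ * D w)) + (W₋ + (ι (size w) * D u₋ + S₋ * D w))
      + (S₊ * K₊ + S₋ * K₋ + (ι (size w) * γ + (S₊ + S₋) * Γ)) ∎))
    (0≤+ (0≤+ good₊ good₋) (subst (0ℚ ≤_) ∑remainder (0≤∑ {n} 0≤remainder)))
    where
    open ≡-Reasoning
    W₊ = weighted u₊ w (shifted 1ℚ)
    W₋ = weighted u₋ w (shifted (- 1ℚ))
    K₊ = ∑ (κ 1ℚ)
    K₋ = ∑ (κ (- 1ℚ))
    Γ  = ∑ (λ y → gap (v₊ y) (v₋ y))
    lemma : ∀ W W′ S S′ K K′ V D D′ c E F →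
      ((W + S * K) + (W′ + S′ * K′)) + (V * (D + D′ + c) + (S + S′) * (E + F))
      ≡ (W + (V * D + S * E)) + (W′ + (V * D′ + S′ * E)) + (S * K + S′ * K′ + (V * c + (S + S′) * F))
    lemma = solve-∀ ring

-- Induction on the dimension. The shift has to be an arbitrary function of y, because `centre` can
-- depend on y even when g is constant.
good-shifted : ∀ {n} (η : Cube n) u v (g : Cube n → ℚ) →
  Good u v (λ x y → (ip η x y + g y) * (ip η x y + g y) - ι n)
-- In dimension 0 both deficiencies vanish and only the square of the shift is left.
good-shifted [] u v g = subst (0ℚ ≤_)
  (sym (lemma (ι (u [])) (ι (v [])) (g []) (G (u [])) (G (v []))))
  (0≤* (0≤* (0≤ι (u [])) (0≤ι (v []))) (0≤p*p (g [])))
  where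
  lemma : ∀ u v g k l →
    u * v * ((0ℚ + g) * (0ℚ + g) - 0ℚ) + (v * (4ℚ * 0ℚ * u + (k - k)) + u * (4ℚ * 0ℚ * v + (l - l)))
    ≡ u * v * (g * g)
  lemma = solve-∀ ring
good-shifted (e ∷ η) u v g =
  good (good-shifted η u₊ w (centre 1ℚ)) (good-shifted η u₋ w (centre (- 1ℚ)))
  where open Step e η u v g

-- Induction on the protocol tree.

0≤gap : ∀ p q → 0ℚ ≤ gap p q
0≤gap p q = subst (0ℚ ≤_) (lemma (gap p q) _)
  (0≤+ (Split.gap-bound (split p q)) (0≤* (0≤ι (p ℕ.+ q)) (0≤p*p (2ℚ * Split.ratio (split p q) - 1ℚ))))
  where
  lemma : ∀ g z → g - z + z ≡ g
  lemma = solve-∀ ring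

weighted-cong : ∀ {m n} (u : Cube m → ℕ) (v : Cube n → ℕ) {Φ Ψ : Cube m → Cube n → ℚ} →
                (∀ x y → Φ x y ≡ Ψ x y) → weighted u v Φ ≡ weighted u v Ψ
weighted-cong {m} {n} u v Φ≗Ψ =
  ∑-cong {m} (λ x → ∑-cong {n} (λ y → cong (ι (u x) * ι (v y) *_) (Φ≗Ψ x y)))

weighted-flip : ∀ {m n} (u : Cube m → ℕ) (v : Cube n → ℕ) (Φ : Cube m → Cube n → ℚ) →
                weighted u v Φ ≡ weighted v u (flip Φ)
weighted-flip {m} {n} u v Φ = trans (∑-swap {m} {n} _)
  (∑-cong {n} (λ y → ∑-cong {m} (λ x → cong (_* Φ x y) (*-comm (ι (u x)) (ι (v y))))))

Good-flip : ∀ {n} (u v : Cube n → ℕ) (Φ : Cube n → Cube n → ℚ) → Good u v Φ → Good v u (flip Φ)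
Good-flip u v Φ = subst (0ℚ ≤_)
  (cong₂ _+_ (weighted-flip u v Φ) (+-comm (ι (size v) * D u) (ι (size u) * D v)))

restrict : Bool → Bool → ℕ → ℕ
restrict true  true  m = m
restrict true  false m = 0
restrict false true  m = 0
restrict false false m = m

-- The side u of the sender is split by the bit a; the 4 in `Φ≡` is the charge for sending it.
module Message {n} (u v : Cube n → ℕ) (a : Cube n → Bool)
  (Φ : Cube n → Cube n → ℚ) (Φ′ : Bool → Cube n → Cube n → ℚ)
  (Φ≡ : ∀ x y → Φ x y ≡ 4ℚ + Φ′ (a x) x y) where

  part : Bool → Cube n → ℕ
  part b x = restrict (a x) b (u x)

  ut uf : Cube n → ℕ
  ut = part true
  uf = part false

  restrict-+ : ∀ b m → m ≡ restrict b true m ℕ.+ restrict b false m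
  restrict-+ true  m = sym (ℕ.+-identityʳ m)
  restrict-+ false m = refl

  -- The point drops out of one of the parts, where it contributes G 0 = 0.
  restrict-G : ∀ b m → G m ≡ G (restrict b true m) + G (restrict b false m)
  restrict-G true  m = sym (+-identityʳ (G m))
  restrict-G false m = sym (+-identityˡ (G m))

  restrict-* : ∀ b m (f : Bool → ℚ) →
               ι m * f b ≡ ι (restrict b true m) * f true + ι (restrict b false m) * f false
  restrict-* true  m f = lemma (ι m * f true) (f false)
    where
    lemma : ∀ x y → x ≡ x + 0ℚ * y
    lemma = solve-∀ ring
  restrict-* false m f = lemma (ι m * f false) (f true)
    where
    lemma : ∀ x y → x ≡ 0ℚ * y + x
    lemma = solve-∀ ring

  size-cong : ∀ {n} {f g : Cube n → ℕ} → (∀ x → f x ≡ g x) → size f ≡ size g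
  size-cong {zero}  f≗g = f≗g []
  size-cong {suc n} f≗g = cong₂ ℕ._+_ (size-cong {n} (λ x → f≗g _)) (size-cong {n} (λ x → f≗g _))

  size-parts : size u ≡ size ut ℕ.+ size uf
  size-parts = trans (size-cong (λ x → restrict-+ (a x) (u x))) (size-+ ut uf)

  -- Since the gap is non-negative, D ut + D uf exceeds D u by at most 4 size u: on average a
  -- message costs at most one bit of entropy.
  D-parts : D u + 4ℚ * ι (size u) ≡ D ut + D uf + gap (size ut) (size uf)
  D-parts = trans
    (cong₂ (λ s g → 4ℚ * ι n * ι s + (g - G s) + 4ℚ * ι s) size-parts
      (trans (∑-cong {n} (λ x → restrict-G (a x) (u x))) (∑-+ {n} _ _)))
    (trans
      (cong (λ s → 4ℚ * ι n * s + (∑ (λ x → G (ut x)) + ∑ (λ x → G (uf x)) - G (size ut ℕ.+ size uf)) + 4ℚ * s)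
            (ι-+ (size ut) (size uf)))
      (lemma (ι n) (ι (size ut)) (ι (size uf))
        (∑ (λ x → G (ut x))) (∑ (λ x → G (uf x))) (G (size ut)) (G (size uf)) _))
    where
    lemma : ∀ n s s′ g g′ k k′ l →
      4ℚ * n * (s + s′) + (g + g′ - l) + 4ℚ * (s + s′)
      ≡ (4ℚ * n * s + (g - k)) + (4ℚ * n * s′ + (g′ - k′)) + (4ℚ * (s + s′) + (k + k′ - l))
    lemma = solve-∀ ring

  weighted-parts : weighted u v Φ
    ≡ weighted ut v (Φ′ true) + weighted uf v (Φ′ false) + ι (size u) * (ι (size v) * 4ℚ)
  weighted-parts = begin
    ∑ (λ x → ∑ (λ y → ι (u x) * ι (v y) * Φ x y))
      ≡⟨ ∑-cong {n} (λ x → trans (∑-cong {n} (point x)) (split-y x)) ⟩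
    ∑ (λ x → ∑ (λ y → ι (ut x) * ι (v y) * Φ′ true x y)
           + ∑ (λ y → ι (uf x) * ι (v y) * Φ′ false x y) + ι (u x) * (ι (size v) * 4ℚ))
      ≡⟨ trans (∑-+ {n} _ _) (cong₂ _+_ (∑-+ {n} _ _)
           (trans (∑-*ʳ {n} _ _) (cong (_* (ι (size v) * 4ℚ)) (sym (ι-size u))))) ⟩
    weighted ut v (Φ′ true) + weighted uf v (Φ′ false) + ι (size u) * (ι (size v) * 4ℚ) ∎
    where
    open ≡-Reasoning
    point : ∀ x y → ι (u x) * ι (v y) * Φ x y
      ≡ ι (ut x) * ι (v y) * Φ′ true x y + ι (uf x) * ι (v y) * Φ′ false x y
        + ι (u x) * (ι (v y) * 4ℚ)
    point x y = begin
      ι (u x) * ι (v y) * Φ x y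
        ≡⟨ cong (ι (u x) * ι (v y) *_) (Φ≡ x y) ⟩
      ι (u x) * ι (v y) * (4ℚ + Φ′ (a x) x y)
        ≡⟨ lemma₁ (ι (u x)) (ι (v y)) (Φ′ (a x) x y) ⟩
      ι (u x) * (ι (v y) * Φ′ (a x) x y) + ι (u x) * (ι (v y) * 4ℚ)
        ≡⟨ cong (_+ ι (u x) * (ι (v y) * 4ℚ)) (trans
             (restrict-* (a x) (u x) (λ b → ι (v y) * Φ′ b x y))
             (sym (cong₂ _+_ (*-assoc (ι (ut x)) (ι (v y)) (Φ′ true x y))
                             (*-assoc (ι (uf x)) (ι (v y)) (Φ′ false x y))))) ⟩
      ι (ut x) * ι (v y) * Φ′ true x y + ι (uf x) * ι (v y) * Φ′ false x y
        + ι (u x) * (ι (v y) * 4ℚ) ∎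
      where
      lemma₁ : ∀ u v f → u * v * (4ℚ + f) ≡ u * (v * f) + u * (v * 4ℚ)
      lemma₁ = solve-∀ ring
    split-y : ∀ x →
      ∑ (λ y → ι (ut x) * ι (v y) * Φ′ true x y + ι (uf x) * ι (v y) * Φ′ false x y
               + ι (u x) * (ι (v y) * 4ℚ))
      ≡ ∑ (λ y → ι (ut x) * ι (v y) * Φ′ true x y)
        + ∑ (λ y → ι (uf x) * ι (v y) * Φ′ false x y) + ι (u x) * (ι (size v) * 4ℚ)
    split-y x = trans (∑-+ {n} _ _) (cong₂ _+_ (∑-+ {n} _ _)
      (trans (∑-*ˡ {n} (ι (u x)) (λ y → ι (v y) * 4ℚ)) (cong (ι (u x) *_)
        (trans (∑-*ʳ {n} 4ℚ _) (cong (_* 4ℚ) (sym (ι-size v)))))))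

  -- The charge, summed over the rectangle, turns D u into D u + 4 size u. By `D-parts` this covers
  -- the deficiencies of both parts and leaves V times a gap.
  Good-message : (∀ b → Good (part b) v (Φ′ b)) → Good u v Φ
  Good-message good = subst (0ℚ ≤_) (sym (begin
    weighted u v Φ + (V * D u + ι (size u) * D v)
      ≡⟨ cong (_+ (V * D u + ι (size u) * D v)) weighted-parts ⟩
    Wt + Wf + ι (size u) * (V * 4ℚ) + (V * D u + ι (size u) * D v)
      ≡⟨ lemma₁ Wt Wf (ι (size u)) V (D u) (D v) ⟩
    Wt + Wf + (V * (D u + 4ℚ * ι (size u)) + ι (size u) * D v)
      ≡⟨ cong₂ (λ d s → Wt + Wf + (V * d + s * D v)) D-parts
               (trans (cong ι size-parts) (ι-+ (size ut) (size uf))) ⟩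
    Wt + Wf + (V * (D ut + D uf + gap (size ut) (size uf)) + (ι (size ut) + ι (size uf)) * D v)
      ≡⟨ lemma₂ Wt Wf V (D ut) (D uf) (gap (size ut) (size uf)) (ι (size ut)) (ι (size uf)) (D v) ⟩
    (Wt + (V * D ut + ι (size ut) * D v)) + (Wf + (V * D uf + ι (size uf) * D v))
      + V * gap (size ut) (size uf) ∎))
    (0≤+ (0≤+ (good true) (good false)) (0≤* (0≤ι (size v)) (0≤gap (size ut) (size uf))))
    where
    open ≡-Reasoning
    V = ι (size v)
    Wt = weighted ut v (Φ′ true)
    Wf = weighted uf v (Φ′ false)
    lemma₁ : ∀ a b U V d e → a + b + U * (V * 4ℚ) + (V * d + U * e) ≡ a + b + (V * (d + 4ℚ * U) + U * e)
    lemma₁ = solve-∀ ring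
    lemma₂ : ∀ a b V d d′ g s s′ e → a + b + (V * (d + d′ + g) + (s + s′) * e)
      ≡ (a + (V * d + s * e)) + (b + (V * d′ + s′ * e)) + V * g
    lemma₂ = solve-∀ ring

module _ {n} (η : Cube n) (l : ℚ) where

  -- The transcript is that of the current subtree, so each step down the tree releases exactly the
  -- charge 4 that `Message` asks for.
  potential : Protocol (Cube n) (Cube n) Sign → Cube n → Cube n → ℚ
  potential π x y = ip η x y * ip η x y - ι n
    + (l * l + 4ℚ * ι (length (transcript π x y)) - 2ℚ * l * (signℚ (run π x y) * ip η x y))

  potential-suc : ∀ k r o → r * r - ι n + (l * l + 4ℚ * ι (suc k) - 2ℚ * l * (o * r))
                         ≡ 4ℚ + (r * r - ι n + (l * l + 4ℚ * ι k - 2ℚ * l * (o * r)))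
  potential-suc k r o = trans
    (cong (λ m → r * r - ι n + (l * l + 4ℚ * m - 2ℚ * l * (o * r))) (ι-+ 1 k))
    (lemma r (ι n) l (ι k) o)
    where
    lemma : ∀ r n l k o → r * r - n + (l * l + 4ℚ * (1ℚ + k) - 2ℚ * l * (o * r))
                        ≡ 4ℚ + (r * r - n + (l * l + 4ℚ * k - 2ℚ * l * (o * r)))
    lemma = solve-∀ ring

  Good-potential : ∀ π u v → Good u v (potential π)
  -- As o² = 1, the potential completes to (⟨x,y⟩ - l o)² - n, a second moment with constant shift.
  Good-potential (output o) u v = subst (0ℚ ≤_)
    (cong (_+ (ι (size v) * D u + ι (size u) * D v)) (weighted-cong u v (λ x y → sym
      (cancel-unit (signℚ-square o) (lemma (ip η x y) (ι n) l (signℚ o))))))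
    (good-shifted η u v (λ _ → - (l * signℚ o)))
    where
    lemma : ∀ r n l o → r * r - n + (l * l + 4ℚ * 0ℚ - 2ℚ * l * (o * r))
      ≡ (r + - (l * o)) * (r + - (l * o)) - n + (o * o - 1ℚ) * (- (l * l))
    lemma = solve-∀ ring
  Good-potential (alice a π) u v = Good-message (λ b → Good-potential (π b) (part b) v)
    where open Message u v a (potential (alice a π)) (λ b → potential (π b))
            (λ x y → potential-suc (length (transcript (π (a x)) x y)) (ip η x y) (signℚ (run (π (a x)) x y)))
  -- Bob's bit splits v, so the two sides are exchanged for this step and exchanged back in the
  -- subtrees.
  Good-potential (bob b π) u v =
    Good-flip v u (flip (potential (bob b π))) (Good-message (λ c →
      Good-flip u (part c) (potential (π c)) (Good-potential (π c) u (part c))))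
    where open Message v u b (flip (potential (bob b π))) (λ c → flip (potential (π c)))
            (λ y x → potential-suc (length (transcript (π (b y)) x y)) (ip η x y) (signℚ (run (π (b y)) x y)))

-- Evaluation on the whole cube.

all-ones : ∀ {n} → Cube n → ℕ
all-ones _ = 1

size-ones : ∀ n → size (all-ones {n}) ≡ 2 ℕ.^ n
size-ones zero    = refl
size-ones (suc n) = cong₂ ℕ._+_ (size-ones n) (trans (size-ones n) (sym (ℕ.+-identityʳ (2 ℕ.^ n))))

∑-const : ∀ n c → ∑ {n} (λ _ → c) ≡ ι (2 ℕ.^ n) * c
∑-const n c = begin
  ∑ {n} (λ _ → c)          ≡⟨ ∑-cong {n} (λ _ → sym (*-identityˡ c)) ⟩
  ∑ {n} (λ _ → 1ℚ * c)     ≡⟨ ∑-*ʳ {n} c (λ _ → 1ℚ) ⟩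
  ∑ {n} (λ _ → 1ℚ) * c     ≡⟨ cong (_* c) (ι-size (all-ones {n})) ⟨
  ι (size (all-ones {n})) * c  ≡⟨ cong (λ s → ι s * c) (size-ones n) ⟩
  ι (2 ℕ.^ n) * c          ∎
  where open ≡-Reasoning

-- Each point contributes G 1 = 0, and G (2ⁿ) is exactly 4 n 2ⁿ.
D-ones : ∀ n → D (all-ones {n}) ≡ 0ℚ
D-ones n = begin
  4ℚ * ι n * ι (size (all-ones {n})) + (∑ {n} (λ _ → 0ℚ) - G (size (all-ones {n})))
    ≡⟨ cong₂ (λ s z → 4ℚ * ι n * ι s + (z - G s)) (size-ones n)
             (trans (∑-const n 0ℚ) (*-zeroʳ (ι (2 ℕ.^ n)))) ⟩
  4ℚ * ι n * ι (2 ℕ.^ n) + (0ℚ - G (2 ℕ.^ n))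
    ≡⟨ cong (λ g → 4ℚ * ι n * ι (2 ℕ.^ n) + (0ℚ - g)) (G-2^ n) ⟩
  4ℚ * ι n * ι (2 ℕ.^ n) + (0ℚ - 4ℚ * ι n * ι (2 ℕ.^ n))
    ≡⟨ lemma (4ℚ * ι n * ι (2 ℕ.^ n)) ⟩
  0ℚ ∎
  where
  open ≡-Reasoning
  lemma : ∀ x → x + (0ℚ - x) ≡ 0ℚ
  lemma = solve-∀ ring

Good-ones : ∀ {n} {Φ : Cube n → Cube n → ℚ} → Good all-ones all-ones Φ → 0ℚ ≤ ∑ (λ x → ∑ (Φ x))
Good-ones {n} {Φ} = subst (0ℚ ≤_) (begin
  weighted {n} {n} all-ones all-ones Φ + (S * D (all-ones {n}) + S * D (all-ones {n}))
    ≡⟨ cong₂ (λ W z → W + (S * z + S * z))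
         (∑-cong {n} (λ x → ∑-cong {n} (λ y → *-identityˡ (Φ x y)))) (D-ones n) ⟩
  ∑ (λ x → ∑ (Φ x)) + (S * 0ℚ + S * 0ℚ)
    ≡⟨ lemma (∑ (λ x → ∑ (Φ x))) S ⟩
  ∑ (λ x → ∑ (Φ x)) ∎)
  where
  open ≡-Reasoning
  S = ι (size (all-ones {n}))
  lemma : ∀ x s → x + (s * 0ℚ + s * 0ℚ) ≡ x
  lemma = solve-∀ ring

∑-ip : ∀ {n} (η y : Cube n) → ∑ (λ x → ip η x y) ≡ 0ℚ
∑-ip []      []      = refl
∑-ip {suc n} (e ∷ η) (t ∷ y) = begin
  ∑ (λ x → signℚ e * (1ℚ * signℚ t) + ip η x y) + ∑ (λ x → signℚ e * (- 1ℚ * signℚ t) + ip η x y)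
    ≡⟨ cong₂ _+_ (half (signℚ e * (1ℚ * signℚ t))) (half (signℚ e * (- 1ℚ * signℚ t))) ⟩
  N * (signℚ e * (1ℚ * signℚ t)) + 0ℚ + (N * (signℚ e * (- 1ℚ * signℚ t)) + 0ℚ)
    ≡⟨ lemma N (signℚ e) (signℚ t) ⟩
  0ℚ ∎
  where
  open ≡-Reasoning
  N = ι (2 ℕ.^ n)
  half : ∀ c → ∑ (λ x → c + ip η x y) ≡ N * c + 0ℚ
  half c = trans (∑-+ {n} _ _) (cong₂ _+_ (∑-const n c) (∑-ip η y))
  lemma : ∀ N e t → N * (e * (1ℚ * t)) + 0ℚ + (N * (e * (- 1ℚ * t)) + 0ℚ) ≡ 0ℚ
  lemma = solve-∀ ring

-- For fixed y the terms ηᵢ xᵢ yᵢ are independent signs of mean zero: cross terms vanish by `∑-ip`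
-- and each square is 1.
∑-ip² : ∀ {n} (η y : Cube n) → ∑ (λ x → ip η x y * ip η x y) ≡ ι (2 ℕ.^ n) * ι n
∑-ip² []      []      = refl
∑-ip² {suc n} (e ∷ η) (t ∷ y) = begin
  ∑ (λ x → (c + ip η x y) * (c + ip η x y)) + ∑ (λ x → (c′ + ip η x y) * (c′ + ip η x y))
    ≡⟨ cong₂ _+_ (half c) (half c′) ⟩
  N * (c * c) + 2ℚ * c * 0ℚ + N * ι n + (N * (c′ * c′) + 2ℚ * c′ * 0ℚ + N * ι n)
    ≡⟨ cancel-unit (signℚ-square e) (lemma N (ι n) (signℚ e) (signℚ t)) ⟩
  N * (ι n + ι n + 2ℚ * (signℚ t * signℚ t))
    ≡⟨ cong (λ z → N * (ι n + ι n + 2ℚ * z)) (signℚ-square t) ⟩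
  N * (ι n + ι n + 2ℚ * 1ℚ)
    ≡⟨ lemma′ N (ι n) ⟩
  2ℚ * N * (1ℚ + ι n)
    ≡⟨ cong₂ _*_ (ι-2^suc n) (ι-+ 1 n) ⟨
  ι (2 ℕ.^ suc n) * ι (suc n) ∎
  where
  open ≡-Reasoning
  N = ι (2 ℕ.^ n)
  c  = signℚ e * (1ℚ * signℚ t)
  c′ = signℚ e * (- 1ℚ * signℚ t)
  expand : ∀ c r → (c + r) * (c + r) ≡ c * c + 2ℚ * c * r + r * r
  expand = solve-∀ ring
  half : ∀ c → ∑ (λ x → (c + ip η x y) * (c + ip η x y)) ≡ N * (c * c) + 2ℚ * c * 0ℚ + N * ι n
  half c = trans (∑-cong {n} (λ x → expand c (ip η x y))) (trans (∑-+ {n} _ _) (cong₂ _+_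
    (trans (∑-+ {n} _ _) (cong₂ _+_ (∑-const n (c * c))
      (trans (∑-*ˡ {n} (2ℚ * c) (λ x → ip η x y)) (cong (2ℚ * c *_) (∑-ip η y)))))
    (∑-ip² η y)))
  lemma : ∀ N n e t →
    N * ((e * (1ℚ * t)) * (e * (1ℚ * t))) + 2ℚ * (e * (1ℚ * t)) * 0ℚ + N * n
    + (N * ((e * (- 1ℚ * t)) * (e * (- 1ℚ * t))) + 2ℚ * (e * (- 1ℚ * t)) * 0ℚ + N * n)
    ≡ N * (n + n + 2ℚ * (t * t)) + (e * e - 1ℚ) * (2ℚ * N * (t * t))
  lemma = solve-∀ ring
  lemma′ : ∀ N n → N * (n + n + 2ℚ * 1ℚ) ≡ 2ℚ * N * (1ℚ + n)
  lemma′ = solve-∀ ring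

∑∑-ip²-n : ∀ {n} (η : Cube n) → ∑ (λ x → ∑ (λ y → ip η x y * ip η x y - ι n)) ≡ 0ℚ
∑∑-ip²-n {n} η = trans (∑-swap {n} {n} _) (trans (∑-cong {n} column)
  (trans (∑-const n 0ℚ) (*-zeroʳ (ι (2 ℕ.^ n)))))
  where
  column : ∀ y → ∑ (λ x → ip η x y * ip η x y - ι n) ≡ 0ℚ
  column y = trans (∑-+ {n} _ _) (trans (cong₂ _+_ (∑-ip² η y) (∑-const n (- ι n)))
    (lemma (ι (2 ℕ.^ n)) (ι n)))
    where
    lemma : ∀ N n → N * n + N * (- n) ≡ 0ℚ
    lemma = solve-∀ ring

-- The potential is used at l equal to the correlation itself, which minimises
-- l² + 4 d - 2 l · correlation.
correlation-bound : ∀ {n} d (π : Protocol (Cube n) (Cube n) Sign) → Communicates≤ d π →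
  ∀ (η : Cube n) l →
  ∑ (λ x → ∑ (λ y → signℚ (run π x y) * ip η x y)) ≡ ι (2 ℕ.^ n) * (ι (2 ℕ.^ n) * l) →
  l * l ≤ 4ℚ * ι d
correlation-bound {n} d π π≤d η l corr = 0≤-⇒≤ (*-cancelˡ-≤-pos (N * N) {{pos}}
  (subst₂ _≤_ (sym (*-zeroʳ (N * N))) total (0≤+ potential-total slack-total)))
  where
  open ≡-Reasoning
  N = ι (2 ℕ.^ n)
  posN = normalize-pos (2 ℕ.^ n) 1 {{_}} {{ℕ.m^n≢0 2 n}}
  pos = pos*pos⇒pos N {{posN}} N {{posN}}
  len : Cube n → Cube n → ℚ
  len x y = ι (length (transcript π x y))
  C : Cube n → Cube n → ℚ
  C x y = signℚ (run π x y) * ip η x y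
  -- Tops up the bits sent on x, y to d, which makes the charge the constant 4 d.
  slack : Cube n → Cube n → ℚ
  slack x y = 4ℚ * (ι d - len x y)
  potential-total : 0ℚ ≤ ∑ (λ x → ∑ (potential η l π x))
  potential-total = Good-ones {n} {potential η l π} (Good-potential η l π all-ones all-ones)
  slack-total : 0ℚ ≤ ∑ (λ x → ∑ (slack x))
  slack-total = 0≤∑ {n} (λ x → 0≤∑ {n} (λ y → 0≤* (0≤ι 4) (≤⇒0≤- (ι-mono (π≤d x y)))))
  ∑∑-+ : ∀ (f g : Cube n → Cube n → ℚ) →
    ∑ (λ x → ∑ (λ y → f x y + g x y)) ≡ ∑ (λ x → ∑ (f x)) + ∑ (λ x → ∑ (g x))
  ∑∑-+ f g = trans (∑-cong {n} (λ x → ∑-+ (f x) (g x))) (∑-+ {n} _ _)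
  point : ∀ x y → potential η l π x y + slack x y
    ≡ (ip η x y * ip η x y - ι n) + ((l * l + 4ℚ * ι d) + (- (2ℚ * l)) * C x y)
  point x y = lemma (ip η x y * ip η x y - ι n) l (len x y) (ι d) (C x y)
    where
    lemma : ∀ r l k d c → r + (l * l + 4ℚ * k - 2ℚ * l * c) + 4ℚ * (d - k)
                        ≡ r + ((l * l + 4ℚ * d) + (- (2ℚ * l)) * c)
    lemma = solve-∀ ring
  total : ∑ (λ x → ∑ (potential η l π x)) + ∑ (λ x → ∑ (slack x)) ≡ N * N * (4ℚ * ι d - l * l)
  total = begin
    ∑ (λ x → ∑ (potential η l π x)) + ∑ (λ x → ∑ (slack x))
      ≡⟨ ∑∑-+ (potential η l π) slack ⟨
    ∑ (λ x → ∑ (λ y → potential η l π x y + slack x y))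
      ≡⟨ ∑-cong {n} (λ x → ∑-cong {n} (point x)) ⟩
    ∑ (λ x → ∑ (λ y → (ip η x y * ip η x y - ι n) + ((l * l + 4ℚ * ι d) + (- (2ℚ * l)) * C x y)))
      -- The second moment cancels n, and `corr` makes the cross term -2 l², so l² + 4 d - 2 l²
      -- remains.
      ≡⟨ trans (∑∑-+ _ _) (cong₂ _+_ (∑∑-ip²-n η) (trans (∑∑-+ _ _) (cong₂ _+_
           (trans (∑-cong {n} (λ _ → ∑-const n _)) (∑-const n _))
           (trans (∑-cong {n} (λ x → ∑-*ˡ (- (2ℚ * l)) (C x)))
             (trans (∑-*ˡ {n} (- (2ℚ * l)) _) (cong (- (2ℚ * l) *_) corr)))))) ⟩
    0ℚ + (N * (N * (l * l + 4ℚ * ι d)) + (- (2ℚ * l)) * (N * (N * l)))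
      ≡⟨ lemma N l (ι d) ⟩
    N * N * (4ℚ * ι d - l * l) ∎
    where
    lemma : ∀ N l d → 0ℚ + (N * (N * (l * l + 4ℚ * d)) + (- (2ℚ * l)) * (N * (N * l)))
                      ≡ N * N * (4ℚ * d - l * l)
    lemma = solve-∀ ring

-- Filtered enumerations and singleton subsets.

module _ {A B : Set} {P : B → Set} (P? : Decidable P) (f : A → B) where

  filter-map : ∀ xs → filter P? (map f xs) ≡ map f (filter (P? ∘ f) xs)
  filter-map []       = refl
  filter-map (x ∷ xs) with P? (f x)
  ... | yes _ = cong (f x ∷_) (filter-map xs)
  ... | no  _ = filter-map xs

  filter-map-none : (∀ x → ¬ P (f x)) → ∀ xs → filter P? (map f xs) ≡ []
  filter-map-none ¬Pf xs = trans (filter-map xs)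
    (cong (map f) (List.filter-none (P? ∘ f) (universal ¬Pf xs)))

module _ {A : Set} {a b : A} (a≢b : a ≢ b) (a∨b : ∀ c → c ≡ a ⊎ c ≡ b) where

  -- As A has exactly the elements a and b, `allVecs` lists each vector once. By uniqueness the half
  -- with the wrong head is filtered out entirely.
  filter-allVecs : ∀ {n} {P : Vec A n → Set} (P? : Decidable P) v → P v → (∀ w → P w → w ≡ v) →
                   filter P? (allVecs a b n) ≡ v ∷ []
  filter-allVecs {zero} P? [] Pv _ = List.filter-accept P? Pv
  filter-allVecs {suc n} P? (c ∷ v) Pv unique
    rewrite List.filter-++ P? (map (a ∷_) (allVecs a b n)) (map (b ∷_) (allVecs a b n))
    with a∨b c
  ... | inj₁ refl = cong₂ _++_
    (trans (filter-map P? (a ∷_) (allVecs a b n)) (cong (map (a ∷_))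
      (filter-allVecs (P? ∘ (a ∷_)) v Pv (λ w Pw → Vec.∷-injectiveʳ (unique (a ∷ w) Pw)))))
    (filter-map-none P? (b ∷_) (λ w Pw → a≢b (sym (Vec.∷-injectiveˡ (unique (b ∷ w) Pw)))) (allVecs a b n))
  ... | inj₂ refl = cong₂ _++_
    (filter-map-none P? (a ∷_) (λ w Pw → a≢b (Vec.∷-injectiveˡ (unique (a ∷ w) Pw))) (allVecs a b n))
    (trans (filter-map P? (b ∷_) (allVecs a b n)) (cong (map (b ∷_))
      (filter-allVecs (P? ∘ (b ∷_)) v Pv (λ w Pw → Vec.∷-injectiveʳ (unique (b ∷ w) Pw)))))

∣S∣≡0⇒⊥ : ∀ {n} (S : Subset n) → Subset.∣ S ∣ ≡ 0 → S ≡ Subset.⊥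
∣S∣≡0⇒⊥ []            _   = refl
∣S∣≡0⇒⊥ (outside ∷ S) S≡0 = cong (outside ∷_) (∣S∣≡0⇒⊥ S S≡0)

inside∨outside : ∀ s → s ≡ inside ⊎ s ≡ outside
inside∨outside inside  = inj₁ refl
inside∨outside outside = inj₂ refl

+∨- : ∀ s → s ≡ Sign.+ ⊎ s ≡ Sign.-
+∨- Sign.+ = inj₁ refl
+∨- Sign.- = inj₂ refl

-- The orders agree because `subsets` lists sets with the first index before those without it. A
-- singleton with the first index is empty elsewhere, hence unique in its half.
singletons : ∀ n → filter (λ S → Subset.∣ S ∣ ℕ.≟ 1) (subsets n) ≡ map ⁅_⁆ (allFin n)
singletons zero    = refl
singletons (suc n) = trans (List.filter-++ P? (map (inside ∷_) (subsets n)) _) (cong₂ _++_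
  (trans (filter-map P? (inside ∷_) (subsets n)) (cong (map (inside ∷_))
    (filter-allVecs (λ ()) inside∨outside (P? ∘ (inside ∷_)) Subset.⊥
      (cong suc (Subset.∣⊥∣≡0 n)) (λ S ∣S∣≡0 → ∣S∣≡0⇒⊥ S (ℕ.suc-injective ∣S∣≡0)))))
  (begin
    filter P? (map (outside ∷_) (subsets n))             ≡⟨ filter-map P? (outside ∷_) (subsets n) ⟩
    map (outside ∷_) (filter (P? ∘ (outside ∷_)) (subsets n)) ≡⟨ cong (map (outside ∷_)) (singletons n) ⟩
    map (outside ∷_) (map ⁅_⁆ (allFin n))                ≡⟨ List.map-∘ (allFin n) ⟨
    map (⁅_⁆ ∘ suc) (allFin n)                           ≡⟨ List.map-tabulate (λ i → i) (⁅_⁆ ∘ suc) ⟩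
    tabulate (⁅_⁆ ∘ suc)                       ≡⟨ List.map-tabulate suc ⁅_⁆ ⟨
    map ⁅_⁆ (tabulate suc)                     ∎))
  where
  open ≡-Reasoning
  P? = λ (S : Subset (suc n)) → Subset.∣ S ∣ ℕ.≟ 1

L₁≡singletonSum : ∀ {n} (f : Cube n → ℚ) → L₁ 1 f ≡ singletonSum f
L₁≡singletonSum {n} f = cong sum (trans (cong (map (λ S → ∣ fourier f S ∣)) (singletons n))
  (sym (List.map-∘ (allFin n))))

-- Means over the cube and Fourier coefficients of the XOR-fiber.

sum-++ : ∀ ps qs → sum (ps ++ qs) ≡ sum ps + sum qs
sum-++ []       qs = sym (+-identityˡ (sum qs))
sum-++ (p ∷ ps) qs = trans (cong (λ r → p + r) (sum-++ ps qs)) (sym (+-assoc p (sum ps) (sum qs)))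

sum-map-cube : ∀ {n} (f : Cube n → ℚ) → sum (map f (cube n)) ≡ ∑ f
sum-map-cube {zero}  f = +-identityʳ (f [])
sum-map-cube {suc n} f = begin
  sum (map f (map (Sign.+ ∷_) (cube n) ++ map (Sign.- ∷_) (cube n)))
    ≡⟨ cong sum (List.map-++ f (map (Sign.+ ∷_) (cube n)) _) ⟩
  sum (map f (map (Sign.+ ∷_) (cube n)) ++ map f (map (Sign.- ∷_) (cube n)))
    ≡⟨ sum-++ (map f (map (Sign.+ ∷_) (cube n))) _ ⟩
  sum (map f (map (Sign.+ ∷_) (cube n))) + sum (map f (map (Sign.- ∷_) (cube n)))
    ≡⟨ cong₂ _+_ (half Sign.+) (half Sign.-) ⟩
  ∑ f ∎
  where
  open ≡-Reasoning
  half : ∀ s → sum (map f (map (s ∷_) (cube n))) ≡ ∑ (λ x → f (s ∷ x))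
  half s = trans (cong sum (sym (List.map-∘ (cube n)))) (sum-map-cube {n} (λ x → f (s ∷ x)))

length-cube : ∀ n → length (cube n) ≡ 2 ℕ.^ n
length-cube zero    = refl
length-cube (suc n) = trans (List.length-++ (map (Sign.+ ∷_) (cube n))) (cong₂ ℕ._+_
  (trans (List.length-map _ (cube n)) (length-cube n))
  (trans (List.length-map _ (cube n)) (trans (length-cube n) (sym (ℕ.+-identityʳ (2 ℕ.^ n))))))

ι*1/ : ∀ m → ι (suc m) * (+ 1 / suc m) ≡ 1ℚ
ι*1/ m = toℚᵘ-injective (begin
  toℚᵘ (ι (suc m) * (+ 1 / suc m))                       ≈⟨ toℚᵘ-homo-* (ι (suc m)) (+ 1 / suc m) ⟩
  toℚᵘ (ι (suc m)) ℚᵘ.* toℚᵘ (+ 1 / suc m)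
    ≈⟨ ℚᵘ.*-cong (toℚᵘ-fromℚᵘ (ℚᵘ.mkℚᵘ (+ suc m) 0)) (toℚᵘ-fromℚᵘ (ℚᵘ.mkℚᵘ (+ 1) m)) ⟩
  ℚᵘ.mkℚᵘ (+ suc m) 0 ℚᵘ.* ℚᵘ.mkℚᵘ (+ 1) m             ≈⟨ ℚᵘ.*≡* (cong +_ lemma) ⟩
  toℚᵘ 1ℚ                                                ∎)
  where
  open ℚᵘ.≃-Reasoning
  lemma : suc m ℕ.* 1 ℕ.* 1 ≡ 1 ℕ.* (1 ℕ.* suc m)
  lemma = trans (trans (ℕ.*-identityʳ (suc m ℕ.* 1)) (ℕ.*-identityʳ (suc m)))
    (sym (trans (ℕ.*-identityˡ (1 ℕ.* suc m)) (ℕ.*-identityˡ (suc m))))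

length*mean : ∀ qs → ι (length qs) * mean qs ≡ sum qs
length*mean []           = refl
length*mean (q ∷ qs) = cancel-unit (ι*1/ (length qs))
  (lemma (ι (suc (length qs))) (sum (q ∷ qs)) (+ 1 / suc (length qs)))
  where
  lemma : ∀ l s r → l * (s * r) ≡ s + (l * r - 1ℚ) * s
  lemma = solve-∀ ring

mean-cube : ∀ {n} (f : Cube n → ℚ) → ι (2 ℕ.^ n) * mean (map f (cube n)) ≡ ∑ f
mean-cube {n} f = trans
  (cong (λ l → ι l * mean (map f (cube n))) (sym (trans (List.length-map f (cube n)) (length-cube n))))
  (trans (length*mean (map f (cube n))) (sum-map-cube f))

⊙-cancel : ∀ {n} (x y : Cube n) → x ⊙ (x ⊙ y) ≡ y
⊙-cancel []      []      = refl
⊙-cancel (s ∷ x) (t ∷ y) = cong₂ _∷_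
  (trans (sym (Sign.*-assoc s s t)) (cong (Sign._* t) (Sign.s*s≡+ s))) (⊙-cancel x y)

-- Each x is its own inverse, so x ⊙ y = z has the single solution y = x ⊙ z. Every fiber thus has
-- 2ⁿ elements, and its mean is normalised by 2ⁿ whatever z is.
fiber : ∀ {n} (z : Cube n) xs →
  filter (λ (x , y) → (x ⊙ y) ≟ z) (cartesianProduct xs (cube n)) ≡ map (λ x → x , x ⊙ z) xs
fiber z []       = refl
fiber {n} z (x ∷ xs) = trans (List.filter-++ P? (map (x ,_) (cube n)) _) (cong₂ _++_
  (trans (filter-map P? (x ,_) (cube n)) (cong (map (x ,_))
    (filter-allVecs (λ ()) +∨- (P? ∘ (x ,_)) (x ⊙ z) (⊙-cancel x z)
      (λ y x⊙y≡z → trans (sym (⊙-cancel x y)) (cong (x ⊙_) x⊙y≡z)))))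
  (fiber z xs))
  where
  P? : Decidable (λ (x , y) → x ⊙ y ≡ z)
  P? (x , y) = (x ⊙ y) ≟ z

xorFiber-sum : ∀ {n} (𝒞 : Cube n → Cube n → Sign) z →
               ι (2 ℕ.^ n) * xorFiber 𝒞 z ≡ ∑ (λ x → signℚ (𝒞 x (x ⊙ z)))
xorFiber-sum {n} 𝒞 z = trans
  (cong (λ l → ι (2 ℕ.^ n) * mean l)
    (trans (cong (map (λ (x , y) → signℚ (𝒞 x y))) (fiber z (cube n))) (sym (List.map-∘ (cube n)))))
  (mean-cube (λ x → signℚ (𝒞 x (x ⊙ z))))

-- Multiplication by x permutes the cube: at each coordinate a minus sign exchanges the two halves.
∑-⊙ : ∀ {n} (x : Cube n) (f : Cube n → ℚ) → ∑ (λ z → f (x ⊙ z)) ≡ ∑ f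
∑-⊙ []             f = refl
∑-⊙ {suc n} (Sign.+ ∷ x) f = cong₂ _+_ (∑-⊙ {n} x _) (∑-⊙ {n} x _)
∑-⊙ {suc n} (Sign.- ∷ x) f = trans (cong₂ _+_ (∑-⊙ {n} x (λ y → f (Sign.- ∷ y))) (∑-⊙ {n} x (λ y → f (Sign.+ ∷ y))))
  (+-comm (∑ {n} _) (∑ {n} _))

-- One factor 2ⁿ clears the mean in the coefficient, the other the mean over the fiber. For fixed x,
-- the substitution z = x ⊙ y then gives a sum over all pairs.
fourier-xorFiber : ∀ {n} (𝒞 : Cube n → Cube n → Sign) S →
  ι (2 ℕ.^ n) * (ι (2 ℕ.^ n) * fourier (xorFiber 𝒞) S)
  ≡ ∑ (λ x → ∑ (λ y → signℚ (𝒞 x y) * signℚ (χ S (x ⊙ y))))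
fourier-xorFiber {n} 𝒞 S = begin
  N * (N * fourier (xorFiber 𝒞) S)
    ≡⟨ cong (N *_) (mean-cube (λ z → xorFiber 𝒞 z * signℚ (χ S z))) ⟩
  N * ∑ (λ z → xorFiber 𝒞 z * signℚ (χ S z))
    ≡⟨ ∑-*ˡ {n} N _ ⟨
  ∑ (λ z → N * (xorFiber 𝒞 z * signℚ (χ S z)))
    ≡⟨ ∑-cong {n} (λ z → trans (sym (*-assoc N (xorFiber 𝒞 z) (signℚ (χ S z))))
         (trans (cong (_* signℚ (χ S z)) (xorFiber-sum 𝒞 z)) (sym (∑-*ʳ {n} (signℚ (χ S z)) _)))) ⟩
  ∑ (λ z → ∑ (λ x → signℚ (𝒞 x (x ⊙ z)) * signℚ (χ S z)))
    ≡⟨ ∑-swap {n} {n} _ ⟩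
  ∑ (λ x → ∑ (λ z → signℚ (𝒞 x (x ⊙ z)) * signℚ (χ S z)))
    ≡⟨ ∑-cong {n} (λ x → trans
         (∑-cong {n} (λ z → cong (λ w → signℚ (𝒞 x (x ⊙ z)) * signℚ (χ S w)) (sym (⊙-cancel x z))))
         (∑-⊙ {n} x (λ y → signℚ (𝒞 x y) * signℚ (χ S (x ⊙ y))))) ⟩
  ∑ (λ x → ∑ (λ y → signℚ (𝒞 x y) * signℚ (χ S (x ⊙ y)))) ∎
  where
  open ≡-Reasoning
  N = ι (2 ℕ.^ n)

-- The singleton sum as a correlation.

module _ {A : Set} where

  sum-map-*ˡ : ∀ c (f : A → ℚ) l → sum (map (λ i → c * f i) l) ≡ c * sum (map f l)
  sum-map-*ˡ c f []      = sym (*-zeroʳ c)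
  sum-map-*ˡ c f (i ∷ l) = trans (cong (λ r → c * f i + r) (sum-map-*ˡ c f l)) (sym (*-distribˡ-+ c (f i) _))

  sum-map-∑ : ∀ {n} (f : A → Cube n → ℚ) l →
              sum (map (λ i → ∑ (f i)) l) ≡ ∑ (λ x → sum (map (λ i → f i x) l))
  sum-map-∑ {n} f []      = sym (trans (∑-const n 0ℚ) (*-zeroʳ (ι (2 ℕ.^ n))))
  sum-map-∑ {n} f (i ∷ l) = trans (cong (λ r → ∑ (f i) + r) (sum-map-∑ f l)) (sym (∑-+ (f i) _))

signℚ-* : ∀ s t → signℚ (s Sign.* t) ≡ signℚ s * signℚ t
signℚ-* Sign.+ Sign.+ = refl
signℚ-* Sign.+ Sign.- = refl
signℚ-* Sign.- Sign.+ = refl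
signℚ-* Sign.- Sign.- = refl

χ-⊥ : ∀ {n} (x : Cube n) → χ Subset.⊥ x ≡ Sign.+
χ-⊥ []      = refl
χ-⊥ (s ∷ x) = χ-⊥ x

-- The character of ⁅ i ⁆ at x ⊙ y is xᵢ yᵢ, the empty remainder of the subset contributing the sign
-- +.
ip-characters : ∀ {n} (η x y : Cube n) →
  sum (map (λ i → signℚ (lookup η i) * signℚ (χ ⁅ i ⁆ (x ⊙ y))) (allFin n)) ≡ ip η x y
ip-characters []      []      []      = refl
ip-characters {suc n} (e ∷ η) (s ∷ x) (t ∷ y) = cong₂ _+_
  (cong (signℚ e *_) (trans
    (cong signℚ (trans (cong (λ c → (s Sign.* t) Sign.* c) (χ-⊥ (x ⊙ y))) (Sign.*-identityʳ (s Sign.* t))))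
    (signℚ-* s t)))
  (trans (cong sum (trans (List.map-tabulate suc F) (sym (List.map-tabulate (λ i → i) (F ∘ suc)))))
         (ip-characters η x y))
  where
  F : Fin (suc n) → ℚ
  F i = signℚ (lookup (e ∷ η) i) * signℚ (χ ⁅ i ⁆ ((s ∷ x) ⊙ (t ∷ y)))

abs-sign : ∀ q → ∃[ s ] ∣ q ∣ ≡ signℚ s * q
abs-sign q with ∣p∣≡p∨∣p∣≡-p q
... | inj₁ ∣q∣≡q  = Sign.+ , trans ∣q∣≡q (sym (*-identityˡ q))
... | inj₂ ∣q∣≡-q = Sign.- , trans ∣q∣≡-q (lemma q)
  where
  lemma : ∀ q → - q ≡ - 1ℚ * q
  lemma = solve-∀ ring

-- Taking ηᵢ to be a sign of the coefficient at ⁅ i ⁆ removes the absolute values. By linearity the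
-- sum over i moves inside, where the signed characters add up to `ip`.
singletonSum-correlation : ∀ {n} (𝒞 : Cube n → Cube n → Sign) → ∃[ η ]
  ∑ (λ x → ∑ (λ y → signℚ (𝒞 x y) * ip η x y))
  ≡ ι (2 ℕ.^ n) * (ι (2 ℕ.^ n) * singletonSum (xorFiber 𝒞))
singletonSum-correlation {n} 𝒞 = η , sym (begin
  N * (N * singletonSum (xorFiber 𝒞))
    ≡⟨ cong (λ l → N * (N * sum l)) (List.map-cong abs (allFin n)) ⟩
  N * (N * sum (map (λ i → σ i * f i) (allFin n)))
    ≡⟨ trans (sum-map-*ˡ N _ (allFin n)) (cong (N *_) (sum-map-*ˡ N _ (allFin n))) ⟨
  sum (map (λ i → N * (N * (σ i * f i))) (allFin n))
    ≡⟨ cong sum (List.map-cong coefficient (allFin n)) ⟩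
  sum (map (λ i → ∑ (λ x → ∑ (λ y → C x y * (σ i * c i x y)))) (allFin n))
    ≡⟨ trans (sum-map-∑ {n = n} _ (allFin n)) (∑-cong {n} (λ x → sum-map-∑ {n = n} _ (allFin n))) ⟩
  ∑ (λ x → ∑ (λ y → sum (map (λ i → C x y * (σ i * c i x y)) (allFin n))))
    ≡⟨ ∑-cong {n} (λ x → ∑-cong {n} (λ y → trans (sum-map-*ˡ (C x y) _ (allFin n))
         (cong (C x y *_) (ip-characters η x y)))) ⟩
  ∑ (λ x → ∑ (λ y → C x y * ip η x y)) ∎)
  where
  open ≡-Reasoning
  N = ι (2 ℕ.^ n)
  f : Fin n → ℚ
  f i = fourier (xorFiber 𝒞) ⁅ i ⁆
  η : Cube n
  η = Vec.tabulate (λ i → proj₁ (abs-sign (f i)))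
  σ : Fin n → ℚ
  σ i = signℚ (lookup η i)
  C : Cube n → Cube n → ℚ
  C x y = signℚ (𝒞 x y)
  c : Fin n → Cube n → Cube n → ℚ
  c i x y = signℚ (χ ⁅ i ⁆ (x ⊙ y))
  abs : ∀ i → ∣ f i ∣ ≡ σ i * f i
  abs i = trans (proj₂ (abs-sign (f i)))
    (cong (λ s → signℚ s * f i) (sym (Vec.lookup∘tabulate (λ i → proj₁ (abs-sign (f i))) i)))
  lemma₁ : ∀ N s f → N * (N * (s * f)) ≡ s * (N * (N * f))
  lemma₁ = solve-∀ ring
  lemma₂ : ∀ s a b → s * (a * b) ≡ a * (s * b)
  lemma₂ = solve-∀ ring
  coefficient : ∀ i → N * (N * (σ i * f i)) ≡ ∑ (λ x → ∑ (λ y → C x y * (σ i * c i x y)))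
  coefficient i = begin
    N * (N * (σ i * f i))                        ≡⟨ lemma₁ N (σ i) (f i) ⟩
    σ i * (N * (N * f i))                        ≡⟨ cong (σ i *_) (fourier-xorFiber 𝒞 ⁅ i ⁆) ⟩
    σ i * ∑ (λ x → ∑ (λ y → C x y * c i x y))
      ≡⟨ trans (∑-cong {n} (λ x → ∑-*ˡ {n} (σ i) _)) (∑-*ˡ {n} (σ i) _) ⟨
    ∑ (λ x → ∑ (λ y → σ i * (C x y * c i x y)))
      ≡⟨ ∑-cong {n} (λ x → ∑-cong {n} (λ y → lemma₂ (σ i) (C x y) (c i x y))) ⟩
    ∑ (λ x → ∑ (λ y → C x y * (σ i * c i x y))) ∎

theorem1p2 : ∃[ C ] (0ℚ < C) ×
    (∀ (n d : ℕ) → 1 ℕ.≤ n → 1 ℕ.≤ d →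
    (π : Protocol (Cube n) (Cube n) Sign) → Communicates≤ d π →
    let h = xorFiber (run π) in
    (L₁ 1 h ≡ singletonSum h) × (singletonSum h ≤ C √ d))
-- The constant is 2 because its square is the 4 of `correlation-bound`.
theorem1p2 = 2ℚ , positive⁻¹ 2ℚ , λ n d _ _ π π≤d →
  let η , corr = singletonSum-correlation (run π) in
  L₁≡singletonSum (xorFiber (run π)) ,
  correlation-bound d π π≤d η (singletonSum (xorFiber (run π))) corr
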